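{- Let $d\geq 0$, $n_0\geq 1$ and $k\geq 1$ be integers. Every graph $G$ with $\operatorname{mad}(G,n_0)<\frac{3}{2} k$ is $k$-choosable with clustering $c:= \max\{\lceil \frac{n_0-1}{k}\rceil, \,57k-51\}$.
   Context: Graphs are finite and simple. For a graph $G$ and integer $n_0\geq 1$, $\operatorname{mad}(G,n_0)$ is the maximum average degree of a subgraph of $G$ with at least $n_0$ vertices, unless $|V(G)|<n_0$, in which case $\operatorname{mad}(G,n_0):=0$. In a coloured graph the monochromatic subgraph is the spanning subgraph of edges whose endpoints have the same colour; its connected components are monochromatic components. A colouring has clustering $c$ if every monochromatic component has at most $c$ vertices. A $k$-list-assignment $L$ assigns to each vertex $v$ a set $L(v)$ of at least $k$ colours; an $L$-colouring colours each $v$ with a colour from $L(v)$. $G$ is $k$-choosable with clustering $c$ if for every $k$-list-assignment $L$, $G$ has an $L$-colouring with clustering $c$. -}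

module Defs where

open import Data.Nat using (ℕ; zero; suc; _+_; _*_; _∸_; _≤_; _<_; _⊔_; NonZero)
open import Data.Nat.DivMod using (_/_)
open import Data.Bool using (Bool; true; false; if_then_else_)
open import Data.Fin using (Fin)
open import Data.Fin.Subset using (Subset; _∈_; ∣_∣)
open import Data.List using (List; length)
open import Data.List.Relation.Unary.All using (All)
open import Data.List.Relation.Unary.Unique.Propositional using (Unique)
import Data.List.Membership.Propositional as LM
open import Data.Product using (Σ; _×_)
open import Relation.Binary.PropositionalEquality using (_≡_)

record Graph : Set where
  field
    n      : ℕ
    adj    : Fin n → Fin n → Bool
    sym    : ∀ u v → adj u v ≡ adj v u
    irrefl : ∀ v → adj v v ≡ false
open Graph public

sumFin : ∀ {m} → (Fin m → ℕ) → ℕ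
sumFin {zero}  f = 0
sumFin {suc m} f = f Fin.zero + sumFin (λ i → f (Fin.suc i))

b2n : Bool → ℕ
b2n true  = 1
b2n false = 0

record Subgraph (G : Graph) : Set where
  field
    verts   : Subset (n G)
    edges   : Fin (n G) → Fin (n G) → Bool
    e-sym   : ∀ u v → edges u v ≡ edges v u
    e-inG   : ∀ u v → edges u v ≡ true → adj G u v ≡ true
    e-inS   : ∀ u v → edges u v ≡ true → (u ∈ verts) × (v ∈ verts)
open Subgraph public

nVerts : ∀ {G} → Subgraph G → ℕ
nVerts H = ∣ verts H ∣

degSum : ∀ {G} → Subgraph G → ℕ
degSum H = sumFin (λ u → sumFin (λ v → b2n (edges H u v)))

-- mad(G, n0) < num / den   (den ≥ 1).
-- mad(G,n0) is the maximum of the average degree degSum H / |V(H)| over the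
-- (finitely many) subgraphs H with |V(H)| ≥ n0, or 0 if |V(G)| < n0.
-- "max < num/den" unfolds to: every such subgraph has average degree < num/den
-- (if |V(G)| < n0 there are no such subgraphs, and 0 < num/den is required).
MadLess : Graph → (n0 num den : ℕ) → Set
MadLess G n0 num den =
  (n G < n0 → 0 < num) ×
  (∀ (H : Subgraph G) → n0 ≤ nVerts H → den * degSum H < num * nVerts H)

ListAssignment : Graph → ℕ → Set
ListAssignment G k =
  Σ (Fin (n G) → List ℕ) λ L → ∀ v → Unique (L v) × (k ≤ length (L v))

data MonoConn (G : Graph) (col : Fin (n G) → ℕ) (u : Fin (n G)) : Fin (n G) → Set where
  here : MonoConn G col u u
  step : ∀ {w v} → MonoConn G col u w → adj G w v ≡ true → col w ≡ col v → MonoConn G col u v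

-- Every monochromatic component has at most c vertices:
-- any list of distinct vertices in the component of u has length ≤ c.
HasClustering : (G : Graph) → (Fin (n G) → ℕ) → ℕ → Set
HasClustering G col c =
  ∀ (u : Fin (n G)) (vs : List (Fin (n G))) →
    Unique vs → All (MonoConn G col u) vs → length vs ≤ c

ChoosableClustered : Graph → ℕ → ℕ → Set
ChoosableClustered G k c =
  ∀ (L : ListAssignment G k) →
    Σ (Fin (n G) → ℕ) λ col →
      (∀ v → col v LM.∈ Data.Product.proj₁ L v) × HasClustering G col c

ceilDiv : ℕ → (k : ℕ) → .{{NonZero k}} → ℕ
ceilDiv a k = (a + (k ∸ 1)) / k

module Submission where

open import Defs hiding (sym; n)
open import Data.Bool using (Bool; true; false; _∧_; _∨_; not; if_then_else_)
import Data.Bool as Bool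
open import Data.Bool.Properties using (∧-zeroʳ)
open import Data.Empty using (⊥; ⊥-elim)
open import Data.Fin using (Fin; zero; suc)
import Data.Fin.Properties as Fin
import Data.Fin.Subset as Subset
open import Data.List using (List; []; _∷_; length; filter; cartesianProductWith)
open import Data.List.Membership.Propositional using (_∈_)
open import Data.List.Membership.Propositional.Properties using (∈-filter⁻; ∈-cartesianProductWith⁺; ∈-cartesianProductWith⁻)
open import Data.List.Properties using (filter-all; filter-accept; filter-reject)
open import Data.List.Relation.Unary.All as All using (All; []; _∷_)
open import Data.List.Relation.Unary.AllPairs using ([]; _∷_)
open import Data.List.Relation.Unary.Any using (here; there)
open import Data.List.Relation.Unary.Unique.Propositional using (Unique)
open import Data.List.Relation.Unary.Unique.Propositional.Properties using (filter⁺)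
open import Data.Nat
open import Data.Nat.DivMod using (m≡m%n+[m/n]*n; m%n<n)
open import Data.Nat.Properties
open import Data.Nat.Tactic.RingSolver using (solve-∀)
open import Data.Product
open import Data.Sum using (_⊎_; inj₁; inj₂)
open import Data.Vec using (Vec; []; _∷_; lookup; _[_]≔_; tabulate)
open import Data.Vec.Properties using (lookup∘update; lookup∘update′; lookup∘tabulate; lookup⇒[]=)
open import Relation.Binary.PropositionalEquality hiding ([_])
open import Relation.Nullary
open import Relation.Nullary.Decidable using (dec-true; dec-false; ¬?; _×-dec_)

-- Let U be a set of vertices, and argue by induction on |U|.  If |U| < n0, colour greedily with
-- balanced colour classes.  Otherwise the density hypothesis yields a nonempty A ⊆ U such that, after
-- deleting from the lists on A the colours used outside, every v ∈ A has deg_A v < 3 |L v|, and the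
-- vertices with deg_A v = 3 |L v| - 1 are pairwise non-adjacent.
--
-- On such a graph take a colouring minimising first the number of monochromatic edges, then the
-- number of vertices in large components.  Components are then paths or cycles, and an inner vertex v
-- that is not tight can be recoloured without changing the number of monochromatic edges; its two
-- neighbours in the new colour a must be ends of components, whose union is its reach.  If the reach
-- has fewer than c vertices, the recolouring creates no new large component.  Starting from a large
-- component, an alternating argument in the style of Haxell's independent transversal theorem collects
-- vertices, each lying in the region reached so far, with disjoint reaches of size at least c: since a
-- component has at most two ends, these block few vertices, whereas about half of the region is
-- recolourable, so another vertex is always available.  If its own reach is small, recolour it: this
-- shrinks an earlier reach, or splits the large component.

-- Linear arithmetic: a ≤ b is the sum of the hypotheses used, and s the remaining slack, so that
-- the equation is a semiring identity.
by-≤ : ∀ {a b x y} → a ≤ b → ∀ s → x + b + s ≡ y + a → x ≤ y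
by-≤ {a} {b} {x} {y} a≤b s eq = +-cancelʳ-≤ b x y (begin
  x + b      ≤⟨ m≤m+n (x + b) s ⟩
  x + b + s  ≡⟨ eq ⟩
  y + a      ≤⟨ +-monoʳ-≤ y a≤b ⟩
  y + b      ∎)
  where open ≤-Reasoning

-- Boolean connectives and decision procedures.

does-sound : ∀ {p} {P : Set p} (d : Dec P) → does d ≡ true → P
does-sound (yes p) _ = p

does-sound-false : ∀ {p} {P : Set p} (d : Dec P) → does d ≡ false → ¬ P
does-sound-false (no ¬p) _ = ¬p

true≢false : true ≢ false
true≢false ()

∧-elimˡ : ∀ {a b} → a ∧ b ≡ true → a ≡ true
∧-elimˡ {true} _ = refl

∧-elimʳ : ∀ {a b} → a ∧ b ≡ true → b ≡ true
∧-elimʳ {true} e = e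

∧-intro : ∀ {a b} → a ≡ true → b ≡ true → a ∧ b ≡ true
∧-intro refl refl = refl

∨-elim : ∀ {a b} → a ∨ b ≡ true → a ≡ true ⊎ b ≡ true
∨-elim {true}  _ = inj₁ refl
∨-elim {false} e = inj₂ e

∨-introˡ : ∀ {a b} → a ≡ true → a ∨ b ≡ true
∨-introˡ refl = refl

∨-introʳ : ∀ {a b} → b ≡ true → a ∨ b ≡ true
∨-introʳ {true}  _ = refl
∨-introʳ {false} e = e

∨-elim-false : ∀ {a b} → a ∨ b ≡ false → a ≡ false × b ≡ false
∨-elim-false {false} e = refl , e

¬true⇒false : ∀ {a} → a ≢ true → a ≡ false
¬true⇒false {true}  h = ⊥-elim (h refl)
¬true⇒false {false} _ = refl

¬false⇒true : ∀ {a} → a ≢ false → a ≡ true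
¬false⇒true {true}  _ = refl
¬false⇒true {false} h = ⊥-elim (h refl)

not-elim : ∀ {a} → not a ≡ true → a ≡ false
not-elim {false} _ = refl

⇔-≡ : ∀ {a b} → (a ≡ true → b ≡ true) → (b ≡ true → a ≡ true) → a ≡ b
⇔-≡ {true}  {b}     f g = sym (f refl)
⇔-≡ {false} {true}  f g = g refl
⇔-≡ {false} {false} f g = refl

b2n-mono : ∀ {a b} → (a ≡ true → b ≡ true) → b2n a ≤ b2n b
b2n-mono {true}  f rewrite f refl = ≤-refl
b2n-mono {false} f = z≤n

b2n≤1 : ∀ a → b2n a ≤ 1
b2n≤1 true  = ≤-refl
b2n≤1 false = z≤n

-- Finite sums

Σ-cong : ∀ {n} {f g : Fin n → ℕ} → (∀ i → f i ≡ g i) → sumFin f ≡ sumFin g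
Σ-cong {zero}  h = refl
Σ-cong {suc n} h = cong₂ _+_ (h zero) (Σ-cong (λ i → h (suc i)))

Σ-mono : ∀ {n} {f g : Fin n → ℕ} → (∀ i → f i ≤ g i) → sumFin f ≤ sumFin g
Σ-mono {zero}  h = z≤n
Σ-mono {suc n} h = +-mono-≤ (h zero) (Σ-mono (λ i → h (suc i)))

Σ-const : ∀ n c → sumFin {n} (λ _ → c) ≡ n * c
Σ-const zero    c = refl
Σ-const (suc n) c = cong (c +_) (Σ-const n c)

Σ-zero : ∀ n → sumFin {n} (λ _ → 0) ≡ 0
Σ-zero n = trans (Σ-const n 0) (*-zeroʳ n)

Σ-+ : ∀ {n} (f g : Fin n → ℕ) → sumFin (λ i → f i + g i) ≡ sumFin f + sumFin g
Σ-+ {zero}  f g = refl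
Σ-+ {suc n} f g rewrite Σ-+ (λ i → f (suc i)) (λ i → g (suc i)) =
  lem (f zero) (g zero) (sumFin (λ i → f (suc i))) (sumFin (λ i → g (suc i)))
  where
  lem : ∀ a b c d → a + b + (c + d) ≡ a + c + (b + d)
  lem = solve-∀

Σ-*ˡ : ∀ {n} c (f : Fin n → ℕ) → sumFin (λ i → c * f i) ≡ c * sumFin f
Σ-*ˡ {zero}  c f = sym (*-zeroʳ c)
Σ-*ˡ {suc n} c f rewrite Σ-*ˡ c (λ i → f (suc i)) = sym (*-distribˡ-+ c (f zero) _)

Σ-swap : ∀ {m n} (f : Fin m → Fin n → ℕ) →
  sumFin (λ i → sumFin (f i)) ≡ sumFin (λ j → sumFin (λ i → f i j))
Σ-swap {zero}  {n} f = sym (Σ-zero n)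
Σ-swap {suc m} {n} f = trans (cong (sumFin (f zero) +_) (Σ-swap (λ i → f (suc i))))
  (sym (Σ-+ (f zero) (λ j → sumFin (λ i → f (suc i) j))))

ΣΣ-+ : ∀ {m n} (f g : Fin m → Fin n → ℕ) → sumFin (λ x → sumFin (λ y → f x y + g x y)) ≡
  sumFin (λ x → sumFin (f x)) + sumFin (λ x → sumFin (g x))
ΣΣ-+ f g = trans (Σ-cong (λ x → Σ-+ (f x) (g x))) (Σ-+ (λ x → sumFin (f x)) (λ x → sumFin (g x)))

Σ-<⇒∃< : ∀ {n} (f g : Fin n → ℕ) → sumFin f < sumFin g → ∃[ i ] f i < g i
Σ-<⇒∃< {suc n} f g h with f zero <? g zero
... | yes p = zero , p
... | no ¬p with Σ-<⇒∃< (λ i → f (suc i)) (λ i → g (suc i))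
                 (≰⇒> (λ q → <⇒≱ h (+-mono-≤ (≮⇒≥ ¬p) q)))
...   | i , q = suc i , q

Σ-mono-< : ∀ {n} {f g : Fin n → ℕ} → (∀ i → f i ≤ g i) → ∀ i → f i < g i → sumFin f < sumFin g
Σ-mono-< h zero    p = +-mono-<-≤ p (Σ-mono (λ i → h (suc i)))
Σ-mono-< h (suc i) p = +-mono-≤-< (h zero) (Σ-mono-< (λ i → h (suc i)) i p)

Σ-term : ∀ {n} (f : Fin n → ℕ) i → f i ≤ sumFin f
Σ-term f zero    = m≤m+n _ _
Σ-term f (suc i) = ≤-trans (Σ-term (λ i → f (suc i)) i) (m≤n+m _ _)

-- Sets of vertices as Boolean predicates

_==_ : ∀ {n} → Fin n → Fin n → Bool
i == j = does (i Fin.≟ j)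

==-refl : ∀ {n} (i : Fin n) → (i == i) ≡ true
==-refl i = dec-true (i Fin.≟ i) refl

==-false : ∀ {n} {i j : Fin n} → i ≢ j → (i == j) ≡ false
==-false {i = i} {j} = dec-false (i Fin.≟ j)

==-sound : ∀ {n} {i j : Fin n} → (i == j) ≡ true → i ≡ j
==-sound {i = i} {j} = does-sound (i Fin.≟ j)

Σ-point : ∀ {n} (v : Fin n) (f : Fin n → ℕ) → sumFin (λ i → b2n (i == v) * f i) ≡ f v
Σ-point {suc n} zero f = trans (cong₂ _+_ (*-identityˡ (f zero))
    (trans (Σ-cong {n} {g = λ _ → 0} (λ i → cong (λ b → b2n b * f (suc i)) (==-false {i = suc i} {zero} (λ ())))) (Σ-zero n)))
  (+-identityʳ (f zero))
Σ-point {suc n} (suc v) f = cong₂ _+_ (cong (λ b → b2n b * f zero) (==-false {i = zero} {suc v} (λ ())))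
  (trans (Σ-cong (λ i → cong (λ b → b2n b * f (suc i)) (==-suc i))) (Σ-point v (λ i → f (suc i))))
  where
  ==-suc : ∀ i → (suc i == suc v) ≡ (i == v)
  ==-suc i = ⇔-≡ {a = suc i == suc v} (λ e → dec-true (i Fin.≟ v) (Fin.suc-injective (==-sound {i = suc i} {suc v} e)))
                                      (λ e → dec-true (suc i Fin.≟ suc v) (cong suc (==-sound {i = i} {v} e)))

# : ∀ {n} → (Fin n → Bool) → ℕ
# S = sumFin (λ i → b2n (S i))

#-cong : ∀ {n} {S R : Fin n → Bool} → (∀ x → S x ≡ R x) → # S ≡ # R
#-cong h = Σ-cong (λ i → cong b2n (h i))

#-mono : ∀ {n} {S R : Fin n → Bool} → (∀ x → S x ≡ true → R x ≡ true) → # S ≤ # R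
#-mono h = Σ-mono (λ i → b2n-mono (h i))

#≤n : ∀ {n} (S : Fin n → Bool) → # S ≤ n
#≤n {n} S = ≤-trans (Σ-mono (λ i → b2n≤1 (S i))) (≤-reflexive (trans (Σ-const n 1) (*-identityʳ n)))

#-single : ∀ {n} (v : Fin n) → # (λ i → i == v) ≡ 1
#-single v = trans (Σ-cong (λ i → sym (*-identityʳ (b2n (i == v))))) (Σ-point v (λ _ → 1))

#-mono-< : ∀ {n} {S R : Fin n → Bool} → (∀ x → S x ≡ true → R x ≡ true) →
  ∀ v → S v ≡ false → R v ≡ true → # S < # R
#-mono-< {S = S} {R} h v p q = Σ-mono-< (λ i → b2n-mono (h i)) v (lem (S v) (R v) p q)
  where
  lem : ∀ a b → a ≡ false → b ≡ true → b2n a < b2n b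
  lem _ _ refl refl = s≤s z≤n

#-pos : ∀ {n} (S : Fin n → Bool) → 0 < # S → ∃[ x ] S x ≡ true
#-pos {n} S h with Σ-<⇒∃< {n} (λ _ → 0) (λ i → b2n (S i)) (subst (_< # S) (sym (Σ-zero n)) h)
... | i , p with S i in e
...   | true  = i , e
...   | false = ⊥-elim (<-irrefl refl p)

insert : ∀ {n} → Fin n → (Fin n → Bool) → Fin n → Bool
insert v S x = S x ∨ (x == v)

#-insert : ∀ {n} (v : Fin n) (S : Fin n → Bool) → S v ≡ false → # (insert v S) ≡ suc (# S)
#-insert v S h = trans (Σ-cong pt) (trans (Σ-+ (λ i → b2n (S i)) (λ i → b2n (i == v)))
    (trans (cong (# S +_) (#-single v)) (+-comm (# S) 1)))
  where
  pt : ∀ i → b2n (S i ∨ (i == v)) ≡ b2n (S i) + b2n (i == v)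
  pt i with i Fin.≟ v
  ... | yes refl rewrite h = refl
  ... | no _ with S i
  ...   | true  = refl
  ...   | false = refl

-- Closure of a seed set under a symmetric relation

module _ {n : ℕ} (M : Fin n → Fin n → Bool) where

  Closed : (Fin n → Bool) → Set
  Closed S = ∀ x y → S x ≡ true → M x y ≡ true → S y ≡ true

  inner : (Fin n → Bool) → ℕ
  inner S = sumFin (λ x → sumFin (λ y → b2n (S x ∧ (S y ∧ M x y))))

  -- Since `inner` counts ordered pairs, `edges` says that the closure spans at least as many edges
  -- as it has vertices beyond the seeds; this holds because every component of it meets a seed.
  record Closure (N : Fin n → Bool) : Set where
    field
      set      : Fin n → Bool
      contains : ∀ x → N x ≡ true → set x ≡ true
      closed   : Closed set
      least    : ∀ B → (∀ x → N x ≡ true → B x ≡ true) → Closed B → ∀ x → set x ≡ true → B x ≡ true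
      edges    : 2 * # set ≤ inner set + 2 * # N

  -- By symmetry, a step out of the complement would reverse to a step out of `S`.
  Closed-∁ : (∀ x y → M x y ≡ M y x) → ∀ {S} → Closed S → Closed (λ x → not (S x))
  Closed-∁ M-sym {S} cl x y p q with S y in e
  ... | false = refl
  ... | true with S x | cl y x e (trans (M-sym y x) q)
  Closed-∁ M-sym {S} cl x y () q | true | true | _

  -- The edge between `w` and `v` contributes two ordered pairs, whose indicators are the products
  -- `β x w * β y v` and `β x v * β y w`.
  inner-insert : (∀ x y → M x y ≡ M y x) → ∀ R w v → R w ≡ true → R v ≡ false → M w v ≡ true →
    inner R + 2 ≤ inner (insert v R)
  inner-insert M-sym R w v Rw Rv Mwv = begin
    inner R + 2
      ≡⟨ cong (inner R +_) (sym two) ⟩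
    inner R + (sumFin (λ x → sumFin (λ y → β x w * β y v)) + sumFin (λ x → sumFin (λ y → β x v * β y w)))
      ≡⟨ cong (inner R +_) (sym (ΣΣ-+ (λ x y → β x w * β y v) (λ x y → β x v * β y w))) ⟩
    inner R + sumFin (λ x → sumFin (λ y → β x w * β y v + β x v * β y w))
      ≡⟨ sym (ΣΣ-+ (λ x y → b2n (R x ∧ (R y ∧ M x y))) (λ x y → β x w * β y v + β x v * β y w)) ⟩
    sumFin (λ x → sumFin (λ y → b2n (R x ∧ (R y ∧ M x y)) + (β x w * β y v + β x v * β y w)))
      ≤⟨ Σ-mono (λ x → Σ-mono (λ y → pt x y)) ⟩
    inner (insert v R) ∎
    where
    open ≤-Reasoning
    β : Fin n → Fin n → ℕ
    β x y = b2n (x == y)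
    one : ∀ a b → sumFin (λ x → sumFin (λ y → β x a * β y b)) ≡ 1
    one a b = trans (Σ-cong (λ x → trans (Σ-*ˡ (β x a) (λ y → β y b)) (trans (cong (β x a *_) (#-single b)) (*-identityʳ _)))) (#-single a)
    two : sumFin (λ x → sumFin (λ y → β x w * β y v)) + sumFin (λ x → sumFin (λ y → β x v * β y w)) ≡ 2
    two = cong₂ _+_ (one w v) (one v w)
    w≢v : w ≢ v
    w≢v refl = true≢false (trans (sym Rw) Rv)
    pt : ∀ x y → b2n (R x ∧ (R y ∧ M x y)) + (β x w * β y v + β x v * β y w) ≤ b2n (insert v R x ∧ (insert v R y ∧ M x y))
    pt x y with x Fin.≟ v
    pt x y | yes refl rewrite ==-false (λ e → w≢v (sym e)) | Rv with y Fin.≟ w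
    ... | no _ = z≤n
    ... | yes refl rewrite Rw | M-sym v w | Mwv = ≤-refl
    pt x y | no x≢v with y Fin.≟ v
    ... | no y≢v with R x | R y | M x y
    ...   | false | _ | _ rewrite *-zeroʳ (β x w) = z≤n
    ...   | true | false | _ rewrite *-zeroʳ (β x w) = z≤n
    ...   | true | true | false rewrite *-zeroʳ (β x w) = z≤n
    ...   | true | true | true rewrite *-zeroʳ (β x w) = ≤-refl
    pt x y | no x≢v | yes refl rewrite Rv with x Fin.≟ w
    ... | yes refl rewrite Rw | Mwv = ≤-refl
    ... | no _ rewrite ∧-zeroʳ (R x) = z≤n

  abstract
    -- Vertices are added one at a time along an edge leaving the current set. Such a vertex lies in
    -- every closed superset and brings an edge with it, which keeps `least` and `edges` true; when
    -- no edge leaves, the set is closed.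
    closure : (∀ x y → M x y ≡ M y x) → ∀ N → Closure N
    closure M-sym N = grow n N (m≤m+n n (# N)) (λ _ p → p) (λ B h _ → h) (m≤n+m _ (inner N))
      where
      grow : ∀ fuel R → n ≤ fuel + # R → (∀ x → N x ≡ true → R x ≡ true) →
        (∀ B → (∀ x → N x ≡ true → B x ≡ true) → Closed B → ∀ x → R x ≡ true → B x ≡ true) →
        2 * # R ≤ inner R + 2 * # N → Closure N
      grow fuel R len N⊆R least edges
        with Fin.any? (λ w → Fin.any? (λ v → (R w ∧ (not (R v) ∧ M w v)) Bool.≟ true))
      ... | no none = record
        { set = R ; contains = N⊆R ; least = least ; edges = edges
        ; closed = λ x y Rx Mxy → ¬false⇒true (λ Ry → none (x , y , ∧-intro Rx (∧-intro (cong not Ry) Mxy))) }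
      ... | yes (w , v , e) = extend fuel len
        where
        Rw : R w ≡ true
        Rw = ∧-elimˡ e
        Mwv : M w v ≡ true
        Mwv = ∧-elimʳ {not (R v)} (∧-elimʳ {R w} e)
        Rv : R v ≡ false
        Rv = not-elim (∧-elimˡ (∧-elimʳ {R w} e))
        card : # (insert v R) ≡ suc (# R)
        card = #-insert v R Rv
        arith : ∀ {a i j N' : ℕ} → 2 * a ≤ i + 2 * N' → i + 2 ≤ j → 2 * suc a ≤ j + 2 * N'
        arith {a} {i} {j} {N'} p q = by-≤ (+-mono-≤ p q) 0 (lem a i j N')
          where
          lem : ∀ a i j N' → 2 * suc a + (i + 2 * N' + j) + 0 ≡ j + 2 * N' + (2 * a + (i + 2))
          lem = solve-∀
        extend : ∀ fuel → n ≤ fuel + # R → Closure N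
        -- Without fuel the current set already has `n` vertices, yet `v` lies outside it.
        extend zero len = ⊥-elim (<⇒≱ (subst (_≤ n) card (#≤n (insert v R))) len)
        extend (suc f) len = grow f (insert v R)
          (≤-trans len (≤-reflexive (trans (sym (+-suc f (# R))) (cong (f +_) (sym card)))))
          (λ x p → ∨-introˡ (N⊆R x p))
          (λ B N⊆B clB x p → leastx B N⊆B clB x (∨-elim p))
          (subst (λ t → 2 * t ≤ inner (insert v R) + 2 * # N) (sym card)
            (arith {N' = # N} edges (inner-insert M-sym R w v Rw Rv Mwv)))
          where
          leastx : ∀ B → (∀ x → N x ≡ true → B x ≡ true) → Closed B → ∀ x → R x ≡ true ⊎ (x == v) ≡ true → B x ≡ true
          leastx B N⊆B clB x (inj₁ p) = least B N⊆B clB x p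
          leastx B N⊆B clB x (inj₂ p) with ==-sound {i = x} {v} p
          ... | refl = clB w v (least B N⊆B clB w Rw) Mwv

-- Splitting counted sets, and the pigeonhole principle for colours.

#-split : ∀ {n} (Q R : Fin n → Bool) → # Q ≡ # (λ y → Q y ∧ R y) + # (λ y → Q y ∧ not (R y))
#-split Q R = trans (Σ-cong (λ y → pt (Q y) (R y))) (Σ-+ (λ y → b2n (Q y ∧ R y)) (λ y → b2n (Q y ∧ not (R y))))
  where
  pt : ∀ a b → b2n a ≡ b2n (a ∧ b) + b2n (a ∧ not b)
  pt false _     = refl
  pt true  true  = refl
  pt true  false = refl

not-does : ∀ {p} {P : Set p} (d : Dec P) → ¬ P → not (does d) ≡ true
not-does d ¬p = cong not (dec-false d ¬p)

remove : ∀ {n} → Fin n → (Fin n → Bool) → Fin n → Bool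
remove v S x = S x ∧ not (x == v)

remove-at : ∀ {n} (v : Fin n) S → remove v S v ≡ false
remove-at v S rewrite ==-refl v = ∧-zeroʳ (S v)

remove-off : ∀ {n} {v x : Fin n} S → x ≢ v → S x ≡ true → remove v S x ≡ true
remove-off S x≢v Sx = ∧-intro Sx (cong not (==-false x≢v))

#-remove : ∀ {n} (v : Fin n) S → S v ≡ true → # S ≡ suc (# (remove v S))
#-remove v S Sv = trans (#-cong same) (#-insert v (remove v S) (remove-at v S))
  where
  same : ∀ x → S x ≡ insert v (remove v S) x
  same x with x Fin.≟ v
  ... | yes refl rewrite Sv = refl
  ... | no _ with S x
  ...   | true  = refl
  ...   | false = refl

unique-length : ∀ {n} (S : Fin n → Bool) vs → Unique vs → All (λ v → S v ≡ true) vs → length vs ≤ # S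
unique-length S [] _ _ = z≤n
unique-length S (v ∷ vs) (v∉ ∷ u) (Sv ∷ Svs) = ≤-trans
  (s≤s (unique-length (remove v S) vs u (All.zipWith (λ (v≢x , Sx) → remove-off S (λ e → v≢x (sym e)) Sx) (v∉ , Svs))))
  (≤-reflexive (sym (#-remove v S Sv)))

-- Distinct colours have disjoint classes. If the class of the head has at least `q` vertices, what
-- is left of `Q` has fewer than `q` times as many vertices as there are colours left.
pigeonhole-colours : ∀ {n} (g : Fin n → ℕ) q as → Unique as → (Q : Fin n → Bool) → # Q < q * length as →
  ∃[ a ] a ∈ as × # (λ y → Q y ∧ does (g y ≟ a)) < q
pigeonhole-colours g q [] u Q h = ⊥-elim (m<n⇒n≢0 h (*-zeroʳ q))
pigeonhole-colours g q (a ∷ as) (a∉ ∷ u) Q h with # (λ y → Q y ∧ does (g y ≟ a)) <? q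
... | yes p = a , here refl , p
... | no ¬p with pigeonhole-colours g q as u (λ y → Q y ∧ not (does (g y ≟ a))) rest
  where
  rest : # (λ y → Q y ∧ not (does (g y ≟ a))) < q * length as
  rest = +-cancelˡ-< q _ _ (begin-strict
    q + # (λ y → Q y ∧ not (does (g y ≟ a)))  ≤⟨ +-monoˡ-≤ _ (≮⇒≥ ¬p) ⟩
    # (λ y → Q y ∧ does (g y ≟ a)) + # (λ y → Q y ∧ not (does (g y ≟ a)))
      ≡⟨ sym (#-split Q (λ y → does (g y ≟ a))) ⟩
    # Q                                       <⟨ h ⟩
    q * suc (length as)                       ≡⟨ *-suc q (length as) ⟩
    q + q * length as                         ∎)
    where open ≤-Reasoning
... | b , b∈ , lt = b , there b∈ , ≤-<-trans (#-mono sub) lt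
  where
  sub : ∀ y → Q y ∧ does (g y ≟ b) ≡ true → (Q y ∧ not (does (g y ≟ a))) ∧ does (g y ≟ b) ≡ true
  sub y e = ∧-intro (∧-intro (∧-elimˡ e) (not-does (g y ≟ a) λ ga → All.lookup a∉ b∈
    (trans (sym ga) (does-sound (g y ≟ b) (∧-elimʳ {Q y} e))))) (∧-elimʳ {Q y} e)

length-remove : ∀ b as → Unique as → length as ≤ suc (length (filter (λ a → ¬? (a ≟ b)) as))
length-remove b [] u = z≤n
length-remove b (a ∷ as) (a∉ ∷ u) = split (a ≟ b)
  where
  P? : ∀ a → Dec (a ≢ b)
  P? a = ¬? (a ≟ b)
  split : Dec (a ≡ b) → suc (length as) ≤ suc (length (filter P? (a ∷ as)))
  split (yes refl) = s≤s (≤-reflexive (cong length (sym (trans (filter-reject P? {a} {as} (λ ne → ne refl))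
    (filter-all P? (All.map (λ ne e → ne (sym e)) a∉))))))
  split (no a≢b) = ≤-trans (s≤s (length-remove b as u))
    (s≤s (≤-reflexive (cong length (sym (filter-accept P? {a} {as} a≢b)))))

-- Finite search for a minimising list colouring.

choices : ∀ {n} → (Fin n → List ℕ) → List (Vec ℕ n)
choices {zero}  L = [] ∷ []
choices {suc n} L = cartesianProductWith _∷_ (L zero) (choices (λ i → L (suc i)))

-- Colourings are vectors because membership asks for equality, whereas functions would agree only
-- pointwise.
choices-complete : ∀ {n} (L : Fin n → List ℕ) (c : Vec ℕ n) → (∀ v → lookup c v ∈ L v) → c ∈ choices L
choices-complete L [] h = here refl
choices-complete L (x ∷ c) h = ∈-cartesianProductWith⁺ _∷_ (h zero) (choices-complete (λ i → L (suc i)) c (λ v → h (suc v)))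

choices-sound : ∀ {n} (L : Fin n → List ℕ) (c : Vec ℕ n) → c ∈ choices L → ∀ v → lookup c v ∈ L v
choices-sound {suc n} L c c∈ v with ∈-cartesianProductWith⁻ _∷_ (L zero) (choices (λ i → L (suc i))) c∈
choices-sound {suc n} L _ c∈ zero    | x , xs , x∈ , xs∈ , refl = x∈
choices-sound {suc n} L _ c∈ (suc v) | x , xs , x∈ , xs∈ , refl = choices-sound (λ i → L (suc i)) xs xs∈ v

minimiser : ∀ {a} {A : Set a} (f : A → ℕ) x xs → ∃[ m ] m ∈ (x ∷ xs) × (∀ {y} → y ∈ (x ∷ xs) → f m ≤ f y)
minimiser f x [] = x , here refl , λ { (here refl) → ≤-refl }
minimiser f x (x′ ∷ xs) with minimiser f x′ xs
... | m , m∈ , least with f x ≤? f m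
...   | yes p = x , here refl , λ { (here refl) → ≤-refl ; (there y∈) → ≤-trans p (least y∈) }
...   | no ¬p = m , there m∈ , λ { (here refl) → <⇒≤ (≰⇒> ¬p) ; (there y∈) → least y∈ }

-- Only pairs meeting `v` change. `cross` sums the relation over the row and the column of `v`,
-- which by symmetry gives twice the degree of `v`. Adding to each relation the cross of itself or
-- of the other makes the summands comparable without subtraction.
ΣΣ-change : ∀ {n} (m m′ : Fin n → Fin n → Bool) v →
  (∀ x y → m x y ≡ m y x) → (∀ x y → m′ x y ≡ m′ y x) → m v v ≡ false → m′ v v ≡ false →
  (∀ x y → x ≢ v → y ≢ v → m′ x y ≡ m x y) →
  sumFin (λ x → # (m′ x)) + 2 * # (m v) ≡ sumFin (λ x → # (m x)) + 2 * # (m′ v)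
ΣΣ-change {n} m m′ v s s′ d d′ off = begin
  sumFin (λ x → # (m′ x)) + 2 * # (m v)
    ≡⟨ cong (sumFin (λ x → # (m′ x)) +_) (sym (Σ-cross m s)) ⟩
  sumFin (λ x → # (m′ x)) + sumFin (λ x → sumFin (cross m x))
    ≡⟨ sym (ΣΣ-+ (λ x y → b2n (m′ x y)) (cross m)) ⟩
  sumFin (λ x → sumFin (λ y → b2n (m′ x y) + cross m x y))
    ≡⟨ Σ-cong (λ x → Σ-cong (λ y → pt x y)) ⟩
  sumFin (λ x → sumFin (λ y → b2n (m x y) + cross m′ x y))
    ≡⟨ ΣΣ-+ (λ x y → b2n (m x y)) (cross m′) ⟩
  sumFin (λ x → # (m x)) + sumFin (λ x → sumFin (cross m′ x))
    ≡⟨ cong (sumFin (λ x → # (m x)) +_) (Σ-cross m′ s′) ⟩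
  sumFin (λ x → # (m x)) + 2 * # (m′ v) ∎
  where
  open ≡-Reasoning
  row col cross : (Fin n → Fin n → Bool) → Fin n → Fin n → ℕ
  row m x y = b2n (x == v) * b2n (m v y)
  col m x y = b2n (y == v) * b2n (m x y)
  cross m x y = row m x y + col m x y
  Σ-cross : ∀ (m : Fin n → Fin n → Bool) → (∀ x y → m x y ≡ m y x) →
    sumFin (λ x → sumFin (cross m x)) ≡ 2 * # (m v)
  Σ-cross m s = trans (ΣΣ-+ (row m) (col m)) (cong₂ _+_
    (trans (Σ-cong (λ x → Σ-*ˡ (b2n (x == v)) (λ y → b2n (m v y)))) (Σ-point v (λ _ → # (m v))))
    (trans (Σ-cong (λ x → trans (Σ-point v (λ y → b2n (m x y))) (cong b2n (s x v)))) (sym (+-identityʳ _))))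
  pt : ∀ x y → b2n (m′ x y) + cross m x y ≡ b2n (m x y) + cross m′ x y
  pt x y with x Fin.≟ v | y Fin.≟ v
  ... | yes refl | yes refl rewrite d | d′ = refl
  ... | yes refl | no _ = lem (b2n (m′ v y)) (b2n (m v y))
    where
    lem : ∀ a b → a + (b + 0 + 0) ≡ b + (a + 0 + 0)
    lem = solve-∀
  ... | no _ | yes refl = lem (b2n (m′ x v)) (b2n (m x v))
    where
    lem : ∀ a b → a + (0 + (b + 0)) ≡ b + (0 + (a + 0))
    lem = solve-∀
  ... | no p | no q rewrite off x y p q = refl

-- Bounds the component of `u` by any Boolean set around `u` that no monochromatic edge leaves.
MonoConn-closed : ∀ G col (S : Fin (Graph.n G) → Bool) →
  (∀ x y → S x ≡ true → adj G x y ≡ true → col x ≡ col y → S y ≡ true) →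
  ∀ {u v} → S u ≡ true → MonoConn G col u v → S v ≡ true
MonoConn-closed G col S closed Su here = Su
MonoConn-closed G col S closed Su (step c e q) = closed _ _ (MonoConn-closed G col S closed Su c) e q

-- The monochromatic relation of a colouring and the recolouring of one vertex.

module Mono (H : Graph) where

  private
    n : ℕ
    n = Graph.n H

  Col : Set
  Col = Vec ℕ n

  deg : Fin n → ℕ
  deg v = # (adj H v)

  -- For `a` the colour of `v` these are its monochromatic neighbours; for another colour, those it
  -- would acquire on receiving `a`.
  nbrs : Col → Fin n → ℕ → Fin n → Bool
  nbrs col v a y = adj H v y ∧ does (lookup col y ≟ a)

  M : Col → Fin n → Fin n → Bool
  M col x = nbrs col x (lookup col x)

  degM : Col → Fin n → ℕ
  degM col v = # (M col v)

  -- Each monochromatic edge is seen from both endpoints, so this is twice their number.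
  E : Col → ℕ
  E col = sumFin (degM col)

  nbrs-adj : ∀ {col v a y} → nbrs col v a y ≡ true → adj H v y ≡ true
  nbrs-adj = ∧-elimˡ

  nbrs-col : ∀ {col v a y} → nbrs col v a y ≡ true → lookup col y ≡ a
  nbrs-col {col} {v} {a} {y} e = does-sound (lookup col y ≟ a) (∧-elimʳ {adj H v y} e)

  nbrs-intro : ∀ {col v a y} → adj H v y ≡ true → lookup col y ≡ a → nbrs col v a y ≡ true
  nbrs-intro {col} {v} {a} {y} e f = ∧-intro e (dec-true (lookup col y ≟ a) f)

  adj-sym : ∀ {x y b} → adj H x y ≡ b → adj H y x ≡ b
  adj-sym {x} {y} e = trans (Graph.sym H y x) e

  M-sym : ∀ col x y → M col x y ≡ M col y x
  M-sym col x y = ⇔-≡ (half x y) (half y x)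
    where
    half : ∀ x y → M col x y ≡ true → M col y x ≡ true
    half x y e = nbrs-intro {col} (adj-sym (nbrs-adj {col} e)) (sym (nbrs-col {col} {x} e))

  M-irrefl : ∀ col x → M col x x ≡ false
  M-irrefl col x rewrite irrefl H x = refl

  cl : Col → (Fin n → Bool) → Fin n → Bool
  cl col N = Closure.set (closure (M col) (M-sym col) N)

  cl-contains : ∀ col N {x} → N x ≡ true → cl col N x ≡ true
  cl-contains col N = Closure.contains (closure (M col) (M-sym col) N) _

  cl-closed : ∀ col N → Closed (M col) (cl col N)
  cl-closed col N = Closure.closed (closure (M col) (M-sym col) N)

  cl-least : ∀ col N B → (∀ x → N x ≡ true → B x ≡ true) → Closed (M col) B → ∀ {x} → cl col N x ≡ true → B x ≡ true
  cl-least col N B h₁ h₂ = Closure.least (closure (M col) (M-sym col) N) B h₁ h₂ _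

  cl-disjoint : ∀ col N B → (∀ x → N x ≡ true → B x ≡ false) → Closed (M col) B → ∀ {x} → cl col N x ≡ true → B x ≡ false
  cl-disjoint col N B h₁ h₂ {x} e = not-elim (cl-least col N (λ x → not (B x)) (λ x p → cong not (h₁ x p)) (Closed-∁ (M col) (M-sym col) h₂) e)

  module Recolour (col : Col) (v : Fin n) (a : ℕ) where

    col′ : Col
    col′ = col [ v ]≔ a

    at : lookup col′ v ≡ a
    at = lookup∘update v col a

    off : ∀ {x} → x ≢ v → lookup col′ x ≡ lookup col x
    off x≢v = lookup∘update′ x≢v col a

    nbrs-off : ∀ x b {y} → y ≢ v → nbrs col′ x b y ≡ nbrs col x b y
    nbrs-off x b {y} y≢v = cong (λ t → adj H x y ∧ does (t ≟ b)) (off y≢v)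

    nbrs-nonadj : ∀ {x} → adj H x v ≡ false → ∀ b y → nbrs col′ x b y ≡ nbrs col x b y
    nbrs-nonadj {x} e b y with y Fin.≟ v
    ... | no y≢v = nbrs-off x b y≢v
    ... | yes refl rewrite e = refl

    M-off : ∀ {x y} → x ≢ v → y ≢ v → M col′ x y ≡ M col x y
    M-off {x} {y} x≢v y≢v rewrite off x≢v = nbrs-off x (lookup col x) y≢v

    M-at : ∀ y → M col′ v y ≡ nbrs col v a y
    M-at y rewrite at = nbrs-nonadj (irrefl H v) a y

    M-nonadj : ∀ {x} → x ≢ v → adj H x v ≡ false → ∀ y → M col′ x y ≡ M col x y
    M-nonadj {x} x≢v e y rewrite off x≢v = nbrs-nonadj e (lookup col x) y

    E-recolour : E col′ + 2 * degM col v ≡ E col + 2 * # (nbrs col v a)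
    E-recolour = trans (ΣΣ-change (M col) (M col′) v (M-sym col) (M-sym col′) (M-irrefl col v) (M-irrefl col′ v) (λ x y → M-off))
      (cong (λ t → E col + 2 * t) (#-cong M-at))

-- D stands for 3 k - 1, which is never 4; an option requires D ≥ 4, the counting D ≥ 5.
module Optimal (H : Graph) (L : Fin (Graph.n H) → List ℕ) (L-unique : ∀ v → Unique (L v)) (D c : ℕ)
  (deg<3L : ∀ v → # (adj H v) < 3 * length (L v))
  (tight-independent : ∀ u v → adj H u v ≡ true → # (adj H u) + # (adj H v) + 3 ≤ 3 * length (L u) + 3 * length (L v))
  (deg≤D : ∀ v → # (adj H v) ≤ D) (D≢4 : 4 ≤ D → 5 ≤ D) (6≤c : 6 ≤ c) (19D≤c+32 : 19 * D ≤ c + 32) where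

  open Mono H

  private
    n : ℕ
    n = Graph.n H

  -- Edge-minimal and optimal colourings.

  LCol : Col → Set
  LCol col = ∀ v → lookup col v ∈ L v

  record EdgeMin (col : Col) : Set where
    constructor edgeMin
    field
      valid : LCol col
      least : ∀ col′ → LCol col′ → E col ≤ E col′

  comp : Col → Fin n → Fin n → Bool
  comp col u = cl col (_== u)

  big : Col → Fin n → Bool
  big col u = does (c <? # (comp col u))

  Φ : Col → ℕ
  Φ col = # (big col)

  -- As `Φ` is at most `n`, this number orders colourings lexicographically, first by `E` and then
  -- by `Φ`.
  cost : Col → ℕ
  cost col = E col * suc n + Φ col

  record Opt (col : Col) : Set where
    constructor opt
    field
      valid : LCol col
      least : ∀ col′ → LCol col′ → cost col ≤ cost col′

  opt⇒edgeMin : ∀ {col} → Opt col → EdgeMin col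
  opt⇒edgeMin {col} (opt lc least) = edgeMin lc λ col′ lc′ → ≮⇒≥ (λ lt → <⇒≱ (cost< col′ lt) (least col′ lc′))
    where
    open ≤-Reasoning
    cost< : ∀ col′ → E col′ < E col → cost col′ < cost col
    cost< col′ lt = begin-strict
      E col′ * suc n + Φ col′ <⟨ +-monoʳ-< (E col′ * suc n) (s≤s (#≤n (big col′))) ⟩
      E col′ * suc n + suc n  ≡⟨ +-comm (E col′ * suc n) (suc n) ⟩
      suc (E col′) * suc n    ≤⟨ *-monoˡ-≤ (suc n) lt ⟩
      E col * suc n           ≤⟨ m≤m+n _ _ ⟩
      cost col                ∎

  LCol-recolour : ∀ col {v a} → LCol col → a ∈ L v → LCol (col [ v ]≔ a)
  LCol-recolour col {v} {a} lc a∈ x with x Fin.≟ v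
  ... | yes refl rewrite lookup∘update x col a = a∈
  ... | no x≢v rewrite lookup∘update′ x≢v col a = lc x

  degM≤nbrs : ∀ {col v a} → EdgeMin col → a ∈ L v → degM col v ≤ # (nbrs col v a)
  degM≤nbrs {col} {v} {a} (edgeMin lc least) a∈ = *-cancelˡ-≤ 2
    (by-≤ (least col′ (LCol-recolour col lc a∈)) 0
      (trans (lem (2 * degM col v) (E col′)) (trans E-recolour (+-comm (E col) _))))
    where
    open Recolour col v a
    lem : ∀ x y → x + y + 0 ≡ y + x
    lem = solve-∀

  -- By pigeonhole some colour of the list occurs at most twice among the neighbours, and moving to
  -- it cannot save monochromatic edges.
  degM≤2 : ∀ {col} → EdgeMin col → ∀ v → degM col v ≤ 2
  degM≤2 {col} em v with pigeonhole-colours (lookup col) 3 (L v) (L-unique v) (adj H v) (deg<3L v)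
  ... | a , a∈ , lt = ≤-trans (degM≤nbrs em a∈) (s≤s⁻¹ lt)

  -- A change of colour at `v` that trades two monochromatic neighbours for at most two, so that `E`
  -- does not grow. In an edge-minimal colouring there are exactly two new ones.
  record Option (col : Col) (v : Fin n) (a : ℕ) : Set where
    field
      degM≡2 : degM col v ≡ 2
      a∈L    : a ∈ L v
      fresh  : a ≢ lookup col v
      nbrs≤2 : # (nbrs col v a) ≤ 2
  open Option

  E-flip : ∀ {col v a} → Option col v a → E (col [ v ]≔ a) ≤ E col
  E-flip {col} {v} {a} o = by-≤ (*-monoʳ-≤ 2 (nbrs≤2 o)) 0
    (trans (+-identityʳ _) (subst (λ t → E col′ + 2 * t ≡ E col + 2 * # (nbrs col v a)) (degM≡2 o) E-recolour))
    where open Recolour col v a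

  edgeMin-flip : ∀ {col v a} → EdgeMin col → Option col v a → EdgeMin (col [ v ]≔ a)
  edgeMin-flip {col} (edgeMin lc least) o = edgeMin (LCol-recolour col lc (a∈L o)) λ col′ lc′ → ≤-trans (E-flip o) (least col′ lc′)

  option-nbrs≥2 : ∀ {col v a} → EdgeMin col → Option col v a → 2 ≤ # (nbrs col v a)
  option-nbrs≥2 {col} {v} {a} em o = subst (_≤ # (nbrs col v a)) (degM≡2 o) (degM≤nbrs em (a∈L o))

  -- After recolouring v the colouring is still edge-minimal, so x has at most two
  -- monochromatic neighbours, and v is a new one.
  option-end : ∀ {col v a} → EdgeMin col → Option col v a → ∀ {x} → nbrs col v a x ≡ true → degM col x ≤ 1
  option-end {col} {v} {a} em o {x} e = s≤s⁻¹ (≤-trans gain (degM≤2 (edgeMin-flip em o) x))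
    where
    open Recolour col v a
    x≢v : x ≢ v
    x≢v refl = true≢false (trans (sym (nbrs-adj {col} {v} {a} {x} e)) (irrefl H v))
    xv-false : M col x v ≡ false
    xv-false = ¬true⇒false λ m → fresh o (trans (sym (nbrs-col {col} {v} {a} {x} e)) (sym (nbrs-col {col} {x} m)))
    xv-true : M col′ x v ≡ true
    xv-true = nbrs-intro {col′} {x} (adj-sym (nbrs-adj {col} {v} {a} {x} e))
      (trans at (sym (trans (off x≢v) (nbrs-col {col} {v} {a} {x} e))))
    gain : suc (degM col x) ≤ degM col′ x
    gain = #-mono-< sub v xv-false xv-true
      where
      sub : ∀ y → M col x y ≡ true → M col′ x y ≡ true
      sub y m with y Fin.≟ v
      ... | yes refl = ⊥-elim (true≢false (trans (sym m) xv-false))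
      ... | no y≢v = trans (M-off x≢v y≢v) m

  -- Flippable vertices and ends: existence of options and counting.

  abstract
    -- Given `deg<3L`, this fails exactly at the tight vertices, those of degree
    -- `3 * length (L z) - 1`.
    slack : Fin n → Bool
    slack z = does (deg z + 2 ≤? 3 * length (L z))

    deg2 : Col → Fin n → Bool
    deg2 col z = does (degM col z ≟ 2)

    end : Col → Fin n → Bool
    end col z = does (degM col z ≤? 1)

    slack-sound : ∀ {z} → slack z ≡ true → deg z + 2 ≤ 3 * length (L z)
    slack-sound {z} = does-sound (deg z + 2 ≤? 3 * length (L z))

    ¬slack-sound : ∀ {z} → slack z ≡ false → 3 * length (L z) < deg z + 2
    ¬slack-sound {z} e = ≰⇒> (does-sound-false (deg z + 2 ≤? 3 * length (L z)) e)

    deg2-sound : ∀ {col z} → deg2 col z ≡ true → degM col z ≡ 2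
    deg2-sound {col} {z} = does-sound (degM col z ≟ 2)

    end-sound : ∀ {col z} → end col z ≡ true → degM col z ≤ 1
    end-sound {col} {z} = does-sound (degM col z ≤? 1)

    end-complete : ∀ {col z} → degM col z ≤ 1 → end col z ≡ true
    end-complete {col} {z} = dec-true (degM col z ≤? 1)

    deg2-or-end : ∀ {col} → EdgeMin col → ∀ z → deg2 col z ≡ false → end col z ≡ true
    deg2-or-end {col} em z h = end-complete {col} (s≤s⁻¹ (≤∧≢⇒< (degM≤2 em z) (does-sound-false (degM col z ≟ 2) h)))

  flippable : Col → Fin n → Bool
  flippable col z = deg2 col z ∧ slack z

  -- Without its current colour the list keeps at least `length (L z) - 1` entries, and `deg z - 2`
  -- neighbours have other colours. Slack makes this fewer than three per entry, so some entry
  -- occurs at most twice.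
  find-option : ∀ {col z} → flippable col z ≡ true → ∃[ a ] Option col z a
  find-option {col} {z} e with pigeonhole-colours (lookup col) 3 as (filter⁺ P? (L-unique z)) Q Q<
    where
    P? : ∀ a → Dec (a ≢ lookup col z)
    P? a = ¬? (a ≟ lookup col z)
    as : List ℕ
    as = filter P? (L z)
    Q : Fin n → Bool
    Q y = adj H z y ∧ not (does (lookup col y ≟ lookup col z))
    Q< : # Q < 3 * length as
    Q< = by-≤ (≤-trans (slack-sound (∧-elimʳ {deg2 col z} e))
                 (*-monoʳ-≤ 3 (length-remove (lookup col z) (L z) (L-unique z)))) 0
           (arith (# Q) (deg z) (length as) (trans (#-split (adj H z) (λ y → does (lookup col y ≟ lookup col z)))
             (cong (_+ # Q) (deg2-sound {col} (∧-elimˡ e)))))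
      where
      lem : ∀ q l → suc q + (3 * suc l) + 0 ≡ 3 * l + (2 + q + 2)
      lem = solve-∀
      arith : ∀ q d l → d ≡ 2 + q → suc q + (3 * suc l) + 0 ≡ 3 * l + (d + 2)
      arith q .(2 + q) l refl = lem q l
  ... | a , a∈ , lt = a , record
    { degM≡2 = deg2-sound {col} (∧-elimˡ e)
    ; a∈L    = proj₁ (∈-filter⁻ P? {xs = L z} a∈)
    ; fresh  = a≢
    ; nbrs≤2 = ≤-trans (#-mono sub) (s≤s⁻¹ lt)
    }
    where
    P? : ∀ a → Dec (a ≢ lookup col z)
    P? a = ¬? (a ≟ lookup col z)
    a≢ : a ≢ lookup col z
    a≢ = proj₂ (∈-filter⁻ P? {xs = L z} a∈)
    sub : ∀ y → nbrs col z a y ≡ true →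
      (adj H z y ∧ not (does (lookup col y ≟ lookup col z))) ∧ does (lookup col y ≟ a) ≡ true
    sub y m = ∧-intro (∧-intro (nbrs-adj {col} m) (not-does (lookup col y ≟ lookup col z)
      (λ s → a≢ (trans (sym (nbrs-col {col} {z} m)) s)))) (∧-elimʳ {adj H z y} m)

  -- Degrees are at most two, and at most one at an end, so the inner degree sum plus the number of
  -- ends is at most twice the size. The edge bound of the closure gives the opposite inequality up
  -- to `2 * # N`.
  cl-ends : ∀ {col} → EdgeMin col → ∀ N → # (λ x → cl col N x ∧ end col x) ≤ 2 * # N
  cl-ends {col} em N = by-≤ (+-mono-≤ (Closure.edges (closure (M col) (M-sym col) N)) upper) 0 (lem (# R) (inner (M col) R) (# (λ x → R x ∧ end col x)) (# N))
    where
    R : Fin n → Bool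
    R = cl col N
    lem : ∀ r i e k → e + (i + 2 * k + 2 * r) + 0 ≡ 2 * k + (2 * r + (i + e))
    lem = solve-∀
    pt : ∀ x → sumFin (λ y → b2n (R x ∧ (R y ∧ M col x y))) + b2n (R x ∧ end col x) ≤ 2 * b2n (R x)
    pt x with R x
    ... | false = ≤-reflexive (trans (+-identityʳ _) (Σ-zero n))
    ... | true with end col x in q
    ...   | true = +-monoˡ-≤ 1 (≤-trans (#-mono {R = M col x} (λ y → ∧-elimʳ {R y})) (end-sound {col} q))
    ...   | false = ≤-trans (≤-reflexive (+-identityʳ _)) (≤-trans (#-mono {R = M col x} (λ y → ∧-elimʳ {R y})) (degM≤2 em x))
    upper : inner (M col) R + # (λ x → R x ∧ end col x) ≤ 2 * # R
    upper = ≤-trans (≤-reflexive (sym (Σ-+ _ (λ x → b2n (R x ∧ end col x)))))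
      (≤-trans (Σ-mono pt) (≤-reflexive (Σ-*ˡ 2 (λ x → b2n (R x)))))

  -- Vertices without slack are pairwise non-adjacent, so counting the monochromatic
  -- edges at those of degree two bounds their number.
  flippable-count : ∀ {col} → EdgeMin col → ∀ T → Closed (M col) T →
    2 * # T ≤ 4 * # (λ x → T x ∧ flippable col x) + 3 * # (λ x → T x ∧ end col x)
  -- Combines `# T ≤ t + f + e` with `2 * t ≤ 2 * f + e`.
  flippable-count {col} em T T-closed = by-≤ (+-mono-≤ (*-monoʳ-≤ 2 partition) tight≤) 0 (lem (# T) t f e)
    where
    tight : Fin n → Bool
    tight z = deg2 col z ∧ not (slack z)
    t f e : ℕ
    t = # (λ x → T x ∧ tight x)
    f = # (λ x → T x ∧ flippable col x)
    e = # (λ x → T x ∧ end col x)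
    lem : ∀ T t f e → 2 * T + (2 * (t + (f + e)) + (2 * f + e)) + 0 ≡ 4 * f + 3 * e + (2 * T + 2 * t)
    lem = solve-∀
    part-pt : ∀ x → b2n (T x) ≤ b2n (T x ∧ tight x) + (b2n (T x ∧ flippable col x) + b2n (T x ∧ end col x))
    part-pt x with T x
    ... | false = z≤n
    ... | true with deg2 col x in q
    ...   | false rewrite deg2-or-end em x q = ≤-refl
    ...   | true with slack x
    ...     | true  = s≤s z≤n
    ...     | false = s≤s z≤n
    partition : # T ≤ t + (f + e)
    partition = ≤-trans (Σ-mono part-pt) (≤-reflexive (trans (Σ-+ (λ x → b2n (T x ∧ tight x)) (λ x → b2n (T x ∧ flippable col x) + b2n (T x ∧ end col x)))
      (cong (t +_) (Σ-+ (λ x → b2n (T x ∧ flippable col x)) (λ x → b2n (T x ∧ end col x))))))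
    -- A tight vertex has degree at least `3 * length (L x) - 1`; two of them on an edge would
    -- exceed the bound of `tight-independent`.
    not-both : ∀ {z y} → adj H z y ≡ true → tight z ≡ true → tight y ≡ false
    not-both {z} {y} zy tz = ¬true⇒false λ ty →
      <⇒≱ (≤-reflexive (cong suc (sym (+-suc (3 * length (L z)) (3 * length (L y))))))
        (≤-trans (+-mono-≤ (lt z tz) (lt y ty))
          (≤-trans (≤-reflexive (assoc (deg z) (deg y))) (s≤s (tight-independent z y zy))))
      where
      lt : ∀ x → tight x ≡ true → 3 * length (L x) < deg x + 2
      lt x tx = ¬slack-sound (not-elim (∧-elimʳ {deg2 col x} tx))
      assoc : ∀ a b → a + 2 + (b + 2) ≡ suc (a + b + 3)
      assoc = solve-∀
    open ≤-Reasoning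
    ind-sum : ∀ (S : Fin n → Bool) x → sumFin (λ y → b2n (S x ∧ M col x y)) ≡ b2n (S x) * degM col x
    ind-sum S x with S x
    ... | true  = sym (+-identityʳ _)
    ... | false = Σ-zero n
    tight-pt : ∀ x → b2n (T x ∧ tight x) * 2 ≡ b2n (T x ∧ tight x) * degM col x
    tight-pt x with T x
    ... | false = refl
    ... | true with deg2 col x in q
    ...   | false = refl
    ...   | true = cong (b2n (not (slack x)) *_) (sym (deg2-sound {col} q))
    loose : Fin n → Bool
    loose x = T x ∧ not (tight x)
    loose-pt : ∀ x → b2n (loose x) * degM col x ≤ 2 * b2n (T x ∧ flippable col x) + b2n (T x ∧ end col x)
    loose-pt x with T x
    ... | false = z≤n
    ... | true with deg2 col x in q
    ...   | false rewrite deg2-or-end em x q = ≤-trans (≤-reflexive (+-identityʳ _)) (end-sound {col} (deg2-or-end em x q))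
    ...   | true with slack x
    ...     | true = ≤-trans (≤-reflexive (trans (+-identityʳ _) (deg2-sound {col} q))) (m≤m+n 2 _)
    ...     | false = z≤n
    tight≤ : 2 * t ≤ 2 * f + e
    tight≤ = begin
      2 * t
        ≡⟨ sym (Σ-*ˡ 2 (λ x → b2n (T x ∧ tight x))) ⟩
      sumFin (λ x → 2 * b2n (T x ∧ tight x))
        ≡⟨ Σ-cong (λ x → trans (*-comm 2 (b2n (T x ∧ tight x))) (trans (tight-pt x) (sym (ind-sum (λ x → T x ∧ tight x) x)))) ⟩
      sumFin (λ x → sumFin (λ y → b2n ((T x ∧ tight x) ∧ M col x y)))
        -- Each pair is now read from its other endpoint, which `not-both` shows to be loose.
        ≤⟨ Σ-mono (λ x → #-mono (λ y p → ∧-intro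
             (∧-intro (T-closed x y (∧-elimˡ (∧-elimˡ p)) (∧-elimʳ {T x ∧ tight x} p))
               (cong not (not-both (nbrs-adj {col} (∧-elimʳ {T x ∧ tight x} p)) (∧-elimʳ {T x} (∧-elimˡ p)))))
             (trans (M-sym col y x) (∧-elimʳ {T x ∧ tight x} p)))) ⟩
      sumFin (λ x → sumFin (λ y → b2n (loose y ∧ M col y x)))
        ≡⟨ Σ-swap (λ x y → b2n (loose y ∧ M col y x)) ⟩
      sumFin (λ y → sumFin (λ x → b2n (loose y ∧ M col y x)))
        ≡⟨ Σ-cong (ind-sum loose) ⟩
      sumFin (λ y → b2n (loose y) * degM col y)
        ≤⟨ Σ-mono loose-pt ⟩
      sumFin (λ y → 2 * b2n (T y ∧ flippable col y) + b2n (T y ∧ end col y))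
        ≡⟨ Σ-+ (λ y → 2 * b2n (T y ∧ flippable col y)) (λ y → b2n (T y ∧ end col y)) ⟩
      sumFin (λ y → 2 * b2n (T y ∧ flippable col y)) + e
        ≡⟨ cong (_+ e) (Σ-*ˡ 2 (λ y → b2n (T y ∧ flippable col y))) ⟩
      2 * f + e ∎

  -- The components that `v` would merge into one, together with itself, on receiving `a`.
  reach : Col → Fin n × ℕ → Fin n → Bool
  reach col (v , a) = cl col (nbrs col v a)

  -- The effect of one recolouring on closures, large components and cost.

  module Flip {col v a} (em : EdgeMin col) (o : Option col v a) where

    open Recolour col v a public

    T X : Fin n → Bool
    T = reach col (v , a)
    X = insert v T

    T-col : ∀ {z} → T z ≡ true → lookup col z ≡ a
    T-col {z} e = does-sound (lookup col z ≟ a) (cl-least col (nbrs col v a) (λ z → does (lookup col z ≟ a))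
      (λ x m → ∧-elimʳ {adj H v x} m)
      (λ x y p m → dec-true (lookup col y ≟ a) (trans (nbrs-col {col} {x} m) (does-sound (lookup col x ≟ a) p))) e)

    v∉T : T v ≡ false
    v∉T = ¬true⇒false λ e → fresh o (sym (T-col e))

    v∈X : X v ≡ true
    v∈X = ∨-introʳ {T v} (==-refl v)

    X-closed : Closed (M col′) X
    X-closed x y Xx m with x Fin.≟ v
    ... | yes refl = ∨-introˡ (cl-contains col (nbrs col v a) (trans (sym (M-at y)) m))
    ... | no x≢v with y Fin.≟ v
    ...   | yes refl = ∨-introʳ {T y} refl
    ...   | no y≢v with ∨-elim {T x} Xx
    ...     | inj₁ Tx = ∨-introˡ (cl-closed col (nbrs col v a) x y Tx (trans (sym (M-off x≢v y≢v)) m))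
    ...     | inj₂ ()

    module _ {N N′ : Fin n → Bool} (N′≗N : ∀ x → N′ x ≡ N x) (N∩X : ∀ x → N x ≡ true → X x ≡ false) where

      -- The old closure minus `X` still contains the seeds, and it is closed because no new
      -- monochromatic edge joins `X` to its complement. Two pointwise equal seed sets are used
      -- since a set of the form `nbrs` is computed from the colouring.
      cl-shrinks : ∀ {x} → cl col′ N′ x ≡ true → cl col N x ∧ not (X x) ≡ true
      cl-shrinks = cl-least col′ N′ (λ x → cl col N x ∧ not (X x))
        (λ x p → ∧-intro (cl-contains col N (trans (sym (N′≗N x)) p)) (cong not (N∩X x (trans (sym (N′≗N x)) p)))) stays
        where
        ≢v : ∀ {x} → not (X x) ≡ true → x ≢ v
        ≢v p refl rewrite v∈X with p
        ... | ()
        stays : Closed (M col′) (λ x → cl col N x ∧ not (X x))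
        stays x y p m = ∧-intro (cl-closed col N x y (∧-elimˡ p) (trans (sym (M-off (≢v x∉) (≢v y∉))) m)) y∉
          where
          x∉ : not (X x) ≡ true
          x∉ = ∧-elimʳ {cl col N x} p
          y∉ : not (X y) ≡ true
          y∉ = Closed-∁ (M col′) (M-sym col′) X-closed x y x∉ m

      -- Away from `v` the two monochromatic relations agree, so a closure that misses `v` survives
      -- in full.
      cl-grows : cl col N v ≡ false → ∀ {x} → cl col N x ≡ true → cl col′ N′ x ≡ true
      cl-grows v∉ {x} e = ∧-elimˡ (cl-least col N (λ x → cl col′ N′ x ∧ cl col N x)
        (λ x p → ∧-intro (cl-contains col′ N′ (trans (N′≗N x) p)) (cl-contains col N p)) stays e)
        where
        ≢v : ∀ {x} → cl col N x ≡ true → x ≢ v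
        ≢v p refl = true≢false (trans (sym p) v∉)
        stays : Closed (M col) (λ x → cl col′ N′ x ∧ cl col N x)
        stays x y p m = ∧-intro (cl-closed col′ N′ x y (∧-elimˡ p) (trans (M-off (≢v x∈) (≢v y∈)) m)) y∈
          where
          x∈ : cl col N x ≡ true
          x∈ = ∧-elimʳ {cl col′ N′ x} p
          y∈ : cl col N y ≡ true
          y∈ = cl-closed col N x y x∈ m

      cl-unchanged : cl col N v ≡ false → ∀ x → cl col′ N′ x ≡ cl col N x
      cl-unchanged v∉ x = ⇔-≡ (λ e → ∧-elimˡ (cl-shrinks e)) (cl-grows v∉)

      -- The new closure avoids `X`, so at least `v` is lost.
      cl-smaller : cl col N v ≡ true → # (cl col′ N′) < # (cl col N)
      cl-smaller v∈ = #-mono-< (λ x e → ∧-elimˡ (cl-shrinks e)) v (¬true⇒false λ e → v∉ (∧-elimʳ {cl col N v} (cl-shrinks e))) v∈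
        where
        v∉ : not (X v) ≢ true
        v∉ p rewrite v∈X with p
        ... | ()

    module _ (free : # T < c) where

      -- The new component stays inside `X`, which has one vertex more than `T` and hence at most
      -- `c`.
      X-small : ∀ u → X u ≡ true → big col′ u ≡ false
      X-small u Xu = dec-false (c <? # (comp col′ u)) (≤⇒≯ (≤-trans (#-mono (λ x → cl-least col′ (_== u) X
        (λ y p → trans (cong X (==-sound {i = y} p)) Xu) X-closed {x})) (≤-trans (≤-reflexive (#-insert v T v∉T)) free)))

      -- By `X-small` such a vertex lies outside `X`, where components can only shrink.
      big-mono : ∀ u → big col′ u ≡ true → big col u ≡ true
      big-mono u b = dec-true (c <? # (comp col u)) (≤-trans (does-sound (c <? # (comp col′ u)) b)
        (#-mono (λ x e → ∧-elimˡ (cl-shrinks {_== u} (λ _ → refl) u∉X {x} e))))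
        where
        u∉X : ∀ x → (x == u) ≡ true → X x ≡ false
        u∉X x p = ¬true⇒false λ Xx → true≢false (trans (sym b) (X-small u (trans (cong X (sym (==-sound {i = x} p))) Xx)))

      cost≤ : cost col′ ≤ cost col
      cost≤ = +-mono-≤ (*-monoˡ-≤ (suc n) (E-flip o)) (#-mono big-mono)

      cost< : big col v ≡ true → cost col′ < cost col
      cost< bv = +-mono-≤-< (*-monoˡ-≤ (suc n) (E-flip o)) (#-mono-< big-mono v (X-small v v∈X) bv)

      opt-flip : Opt col → Opt col′
      opt-flip (opt lc least) = opt (LCol-recolour col lc (a∈L o)) λ col″ lc″ → ≤-trans cost≤ (least col″ lc″)

      ¬big-v : Opt col → big col v ≡ false
      ¬big-v (opt lc least) = ¬true⇒false λ bv → <⇒≱ (cost< bv) (least col′ (LCol-recolour col lc (a∈L o)))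

  -- Chains of blocked recolourings.

  K : ℕ
  K = suc (suc n)

  -- Sizes of reaches as digits in base `n + 2`, the oldest link being the most significant. Digits
  -- are at most `n`; the extra unit in the base makes the measure of `no-chain` drop strictly when
  -- a digit is appended.
  code : Col → List (Fin n × ℕ) → ℕ
  code col [] = 0
  code col (w ∷ ws) = code col ws * K + # (reach col w)

  -- A chain is rooted at the large component of p; performing any of its recolourings would
  -- create another large component.
  module Chains (p : Fin n) where

    region : Col → List (Fin n × ℕ) → Fin n → Bool
    region col [] = comp col p
    region col (w ∷ ws) x = reach col w x ∨ region col ws x

    -- Recolouring such a `v` changes neither the colours of the vertices of the links nor the
    -- colours in their neighbourhoods.
    Apart : Fin n → List (Fin n × ℕ) → Set
    Apart v = All (λ w → v ≢ proj₁ w × adj H (proj₁ w) v ≡ false)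

    -- The region is a union of components, so `clean` makes the new reach disjoint from it. `apart`
    -- keeps the earlier options valid if this vertex is recoloured.
    record Candidate (col : Col) (w : Fin n × ℕ) (ws : List (Fin n × ℕ)) : Set where
      constructor candidate
      field
        option : Option col (proj₁ w) (proj₂ w)
        inside : region col ws (proj₁ w) ≡ true
        clean  : ∀ x → nbrs col (proj₁ w) (proj₂ w) x ≡ true → region col ws x ≡ false
        apart  : Apart (proj₁ w) ws

    data Chain (col : Col) : List (Fin n × ℕ) → Set where
      root : c < # (comp col p) → Chain col []
      link : ∀ {w ws} → Chain col ws → Candidate col w ws → c ≤ # (reach col w) → Chain col (w ∷ ws)

    region-closed : ∀ col ws → Closed (M col) (region col ws)
    region-closed col [] = cl-closed col (_== p)
    region-closed col ((v , a) ∷ ws) x y e m with ∨-elim {reach col (v , a) x} e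
    ... | inj₁ q = ∨-introˡ (cl-closed col (nbrs col v a) x y q m)
    ... | inj₂ q = ∨-introʳ {reach col (v , a) y} (region-closed col ws x y q m)

    reach-clean : ∀ {col v a ws} → (∀ x → nbrs col v a x ≡ true → region col ws x ≡ false) →
      ∀ {x} → reach col (v , a) x ≡ true → region col ws x ≡ false
    reach-clean {col} {v} {a} {ws} cln = cl-disjoint col (nbrs col v a) (region col ws) cln (region-closed col ws)

    -- Performing the recolouring of a candidate and truncating its chain.

    module Descent {col v a} (em : EdgeMin col) (o : Option col v a) where

      open Flip em o

      region-avoids-X : ∀ ws → region col ws v ≡ false → (∀ x → nbrs col v a x ≡ true → region col ws x ≡ false) →
        ∀ x → region col ws x ≡ true → X x ≡ false
      region-avoids-X ws v∉ cln x rx = ¬true⇒false λ Xx → bad (∨-elim {T x} Xx)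
        where
        bad : T x ≡ true ⊎ (x == v) ≡ true → ⊥
        bad (inj₁ Tx) = true≢false (trans (sym rx) (reach-clean {col} {v} {a} {ws} cln Tx))
        bad (inj₂ q) with ==-sound {i = x} q
        ... | refl = true≢false (trans (sym rx) v∉)

      nbrs-avoid-X : ∀ v₁ a₁ → adj H v₁ v ≡ false →
        (∀ x → nbrs col v a x ≡ true → reach col (v₁ , a₁) x ≡ false) →
        ∀ x → nbrs col v₁ a₁ x ≡ true → X x ≡ false
      nbrs-avoid-X v₁ a₁ v₁v cln x m = ¬true⇒false λ Xx → bad (∨-elim {T x} Xx)
        where
        bad : T x ≡ true ⊎ (x == v) ≡ true → ⊥
        bad (inj₁ Tx) = true≢false (trans (sym (cl-contains col (nbrs col v₁ a₁) m))
          (cl-disjoint col (nbrs col v a) (reach col (v₁ , a₁)) cln (cl-closed col (nbrs col v₁ a₁)) Tx))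
        bad (inj₂ q) with ==-sound {i = x} q
        ... | refl = true≢false (trans (sym (nbrs-adj {col} m)) v₁v)

      record Preserved (ws : List (Fin n × ℕ)) : Set where
        field
          chain′  : Chain col′ ws
          region′ : ∀ x → region col′ ws x ≡ region col ws x
          code′   : code col′ ws ≡ code col ws
      open Preserved

      candidate′ : ∀ {v₁ a₁ ws} → v ≢ v₁ → adj H v₁ v ≡ false → (∀ x → region col′ ws x ≡ region col ws x) →
        Candidate col (v₁ , a₁) ws → Candidate col′ (v₁ , a₁) ws
      candidate′ {v₁} {a₁} v≢ v₁v reg (candidate o₁ ins cln ap) = candidate
        (record { degM≡2 = trans (#-cong (M-nonadj (λ e → v≢ (sym e)) v₁v)) (degM≡2 o₁)
                ; a∈L = a∈L o₁
                ; fresh = λ e → fresh o₁ (trans e (off (λ e → v≢ (sym e))))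
                ; nbrs≤2 = ≤-trans (≤-reflexive (#-cong (nbrs-nonadj v₁v a₁))) (nbrs≤2 o₁) })
        (trans (reg v₁) ins)
        (λ x m → trans (reg x) (cln x (trans (sym (nbrs-nonadj v₁v a₁ x)) m)))
        ap

      -- Every closure involved misses `v` and has its seeds off `X`, so `cl-unchanged` applies link
      -- by link.
      preserve : ∀ {ws} → Chain col ws → region col ws v ≡ false →
        (∀ x → nbrs col v a x ≡ true → region col ws x ≡ false) → Apart v ws → Preserved ws
      preserve {[]} (root P>c) v∉ cln ap = record
        { chain′ = root (≤-trans P>c (≤-reflexive (sym (#-cong same)))) ; region′ = same ; code′ = refl }
        where
        same : ∀ x → comp col′ p x ≡ comp col p x
        same = cl-unchanged (λ _ → refl) (λ x e → region-avoids-X [] v∉ cln x (cl-contains col (_== p) e)) v∉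
      preserve {(v₁ , a₁) ∷ ws} (link ch cand blocked) v∉ cln ((v≢ , v₁v) ∷ ap) = record
        { chain′ = link (chain′ ih) (candidate′ v≢ v₁v (region′ ih) cand) (≤-trans blocked (≤-reflexive (sym (#-cong same))))
        ; region′ = λ x → cong₂ _∨_ (same x) (region′ ih x)
        ; code′ = cong₂ (λ s t → s * K + t) (code′ ih) (#-cong same) }
        where
        ih : Preserved ws
        ih = preserve ch (proj₂ (∨-elim-false v∉)) (λ x m → proj₂ (∨-elim-false {reach col (v₁ , a₁) x} (cln x m))) ap
        same : ∀ x → reach col′ (v₁ , a₁) x ≡ reach col (v₁ , a₁) x
        same = cl-unchanged (nbrs-nonadj v₁v a₁)
          (nbrs-avoid-X v₁ a₁ v₁v (λ x m → proj₁ (∨-elim-false (cln x m)))) (proj₁ (∨-elim-false v∉))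

      -- The link `w₁` is the one whose reach contains `v`, with `dropped` newer links removed. It
      -- is kept only as a candidate, since its reach has shrunk and may now have fewer than `c`
      -- vertices.
      record Descended (ws : List (Fin n × ℕ)) : Set where
        field
          w₁        : Fin n × ℕ
          rest      : List (Fin n × ℕ)
          dropped   : ℕ
          lengths   : suc (length rest) + dropped ≡ length ws
          chain₁    : Chain col′ rest
          cand₁     : Candidate col′ w₁ rest
          code≤     : code col (w₁ ∷ rest) * K ^ dropped ≤ code col ws
          code<     : code col′ (w₁ ∷ rest) < code col (w₁ ∷ rest)
      open Descended

      -- Links are discarded, newest first, as long as `v` lies in the region of the older ones. The
      -- link reached then loses `v` from its reach, while the older links are preserved.
      descend : ∀ {ws} → Chain col ws → comp col p v ≡ false → region col ws v ≡ true →
        (∀ x → nbrs col v a x ≡ true → region col ws x ≡ false) → Apart v ws → Descended ws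
      descend {[]} ch v∉P v∈ cln ap = ⊥-elim (true≢false (trans (sym v∈) v∉P))
      descend {(v₁ , a₁) ∷ ws} (link ch cand blocked) v∉P v∈ cln ((v≢ , v₁v) ∷ ap) = split (region col ws v) refl
        where
        cln′ : ∀ x → nbrs col v a x ≡ true → region col ws x ≡ false
        cln′ x m = proj₂ (∨-elim-false {reach col (v₁ , a₁) x} (cln x m))
        split : ∀ b → region col ws v ≡ b → Descended ((v₁ , a₁) ∷ ws)
        split true e = record
          { w₁ = w₁ ih ; rest = rest ih ; dropped = suc (dropped ih)
          ; lengths = trans (+-suc (suc (length (rest ih))) (dropped ih)) (cong suc (lengths ih))
          ; chain₁ = chain₁ ih ; cand₁ = cand₁ ih ; code< = code< ih
          ; code≤ = ≤-trans (≤-reflexive (arith (code col (w₁ ih ∷ rest ih)) K (K ^ dropped ih)))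
              (≤-trans (*-monoˡ-≤ K (code≤ ih)) (m≤m+n (code col ws * K) (# (reach col (v₁ , a₁))))) }
          where
          ih : Descended ws
          ih = descend ch v∉P e cln′ ap
          arith : ∀ x k y → x * (k * y) ≡ x * y * k
          arith = solve-∀
        split false e = record
          { w₁ = v₁ , a₁ ; rest = ws ; dropped = 0 ; lengths = +-identityʳ _
          ; chain₁ = chain′ pr ; cand₁ = candidate′ v≢ v₁v (region′ pr) cand
          ; code≤ = ≤-reflexive (*-identityʳ _)
          ; code< = subst (λ t → t * K + # (reach col′ (v₁ , a₁)) < code col ((v₁ , a₁) ∷ ws)) (sym (code′ pr))
              (+-monoʳ-< (code col ws * K) (cl-smaller (nbrs-nonadj v₁v a₁)
                (nbrs-avoid-X v₁ a₁ v₁v (λ x m → proj₁ (∨-elim-false (cln x m)))) v∈T₁)) }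
          where
          pr : Preserved ws
          pr = preserve ch e cln′ ap
          v∈T₁ : reach col (v₁ , a₁) v ≡ true
          v∈T₁ with ∨-elim {reach col (v₁ , a₁) v} v∈
          ... | inj₁ q = q
          ... | inj₂ q = ⊥-elim (true≢false (trans (sym q) e))

    -- Finding the next candidate by counting.

    endsAt : Col → (Fin n → Bool) → Fin n → ℕ
    endsAt col T z = sumFin (λ x → b2n ((T x ∧ end col x) ∧ adj H x z))

    -- weight col ws z = 0 ensures that any option at z is clean and apart from ws.
    weight : Col → List (Fin n × ℕ) → Fin n → ℕ
    weight col [] z = endsAt col (comp col p) z
    weight col ((v , a) ∷ ws) z = (b2n (z == v) + b2n (adj H v z) + endsAt col (reach col (v , a)) z) + weight col ws z

    Σ-endsAt : ∀ col T → sumFin (endsAt col T) ≤ # (λ x → T x ∧ end col x) * D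
    Σ-endsAt col T = begin
      sumFin (endsAt col T)
        ≡⟨ Σ-swap (λ z x → b2n ((T x ∧ end col x) ∧ adj H x z)) ⟩
      sumFin (λ x → # (λ z → (T x ∧ end col x) ∧ adj H x z))
        ≤⟨ Σ-mono pt ⟩
      sumFin (λ x → D * b2n (T x ∧ end col x))
        ≡⟨ Σ-*ˡ D (λ x → b2n (T x ∧ end col x)) ⟩
      D * # (λ x → T x ∧ end col x)
        ≡⟨ *-comm D (# (λ x → T x ∧ end col x)) ⟩
      # (λ x → T x ∧ end col x) * D ∎
      where
      open ≤-Reasoning
      pt : ∀ x → # (λ z → (T x ∧ end col x) ∧ adj H x z) ≤ D * b2n (T x ∧ end col x)
      pt x with T x ∧ end col x
      ... | true  = ≤-trans (deg≤D x) (≤-reflexive (sym (*-identityʳ D)))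
      ... | false = ≤-trans (≤-reflexive (Σ-zero n)) z≤n

    -- With at most two ends, a component of more than `c` vertices has more flippable vertices than
    -- its ends have neighbours.
    root-arith : ∀ {P f e} → c < P → 2 * P ≤ 4 * f + 3 * e → e ≤ 2 → 5 ≤ D → e * D < f
    root-arith {P} {f} {e} h₁ h₂ h₃ h₄ = ≤-<-trans (*-monoˡ-≤ D h₃) (*-cancelˡ-≤ 4
      (by-≤ (+-mono-≤ (*-monoʳ-≤ 2 h₁) (+-mono-≤ h₂ (+-mono-≤ (*-monoʳ-≤ 3 h₃) (+-mono-≤ (*-monoʳ-≤ 2 19D≤c+32) (*-monoʳ-≤ 30 h₄)))))
        78 (lem P f e D c)))
      where
      lem : ∀ P f e D c → 4 * suc (2 * D) + (2 * P + (4 * f + 3 * e + (6 + (2 * (c + 32) + 30 * D)))) + 78 ≡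
        4 * f + (2 * suc c + (2 * P + (3 * e + (2 * (19 * D) + 150))))
      lem = solve-∀

    -- A blocked reach has at most four ends, and `1 + D` accounts for the vertex of the link and
    -- its neighbours. After doubling `c + 32 ≥ 19 * D`, what must be covered is `18 * D ≥ 84`; this
    -- is where `5 ≤ D` enters.
    link-arith : ∀ {T f e} → c ≤ T → 2 * T ≤ 4 * f + 3 * e → e ≤ 4 → 5 ≤ D → 1 + D + e * D < f
    link-arith {T} {f} {e} h₁ h₂ h₃ h₄ = ≤-<-trans (+-monoʳ-≤ (1 + D) (*-monoˡ-≤ D h₃)) (*-cancelˡ-≤ 4
      (by-≤ (+-mono-≤ (*-monoʳ-≤ 2 h₁) (+-mono-≤ h₂ (+-mono-≤ (*-monoʳ-≤ 3 h₃) (+-mono-≤ (*-monoʳ-≤ 2 19D≤c+32) (*-monoʳ-≤ 18 h₄)))))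
        6 (lem T f e D c)))
      where
      lem : ∀ T f e D c → 4 * suc (1 + D + 4 * D) + (2 * T + (4 * f + 3 * e + (12 + (2 * (c + 32) + 18 * D)))) + 6 ≡
        4 * f + (2 * c + (2 * T + (3 * e + (2 * (19 * D) + 90))))
      lem = solve-∀

    comp-ends≤2 : ∀ {col} → EdgeMin col → # (λ x → comp col p x ∧ end col x) ≤ 2
    comp-ends≤2 em = ≤-trans (cl-ends em (_== p)) (≤-reflexive (cong (2 *_) (#-single p)))

    reach-ends≤4 : ∀ {col v a} → EdgeMin col → Option col v a → # (λ x → reach col (v , a) x ∧ end col x) ≤ 4
    reach-ends≤4 {col} {v} {a} em o = ≤-trans (cl-ends em (nbrs col v a)) (*-monoʳ-≤ 2 (nbrs≤2 o))

    Flippable : Col → List (Fin n × ℕ) → Fin n → Bool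
    Flippable col ws x = region col ws x ∧ flippable col x

    -- The root and each link supply more flippable vertices than the weight they add, and
    -- disjointness of the reaches lets these surpluses be summed.
    Σ-weight : ∀ {col ws} → EdgeMin col → 5 ≤ D → Chain col ws → sumFin (weight col ws) < # (Flippable col ws)
    Σ-weight {col} em 5≤D (root P>c) = ≤-<-trans (Σ-endsAt col (comp col p))
      (root-arith P>c (flippable-count em (comp col p) (cl-closed col (_== p))) (comp-ends≤2 em) 5≤D)
    Σ-weight {col} {(v , a) ∷ ws} em 5≤D (link ch (candidate o ins cln ap) blocked) = begin-strict
      sumFin (weight col ((v , a) ∷ ws))
        ≡⟨ Σ-+ (λ z → b2n (z == v) + b2n (adj H v z) + endsAt col T z) (weight col ws) ⟩
      sumFin (λ z → b2n (z == v) + b2n (adj H v z) + endsAt col T z) + sumFin (weight col ws)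
        ≡⟨ cong (_+ sumFin (weight col ws)) (trans (Σ-+ (λ z → b2n (z == v) + b2n (adj H v z)) (endsAt col T))
             (cong (_+ sumFin (endsAt col T)) (Σ-+ (λ z → b2n (z == v)) (λ z → b2n (adj H v z))))) ⟩
      # (_== v) + deg v + sumFin (endsAt col T) + sumFin (weight col ws)
        ≤⟨ +-monoˡ-≤ _ (+-mono-≤ (+-mono-≤ (≤-reflexive (#-single v)) (deg≤D v)) (Σ-endsAt col T)) ⟩
      1 + D + # (λ x → T x ∧ end col x) * D + sumFin (weight col ws)
        <⟨ +-mono-< (link-arith blocked (flippable-count em T (cl-closed col (nbrs col v a))) (reach-ends≤4 em o) 5≤D)
             (Σ-weight em 5≤D ch) ⟩
      # (λ x → T x ∧ flippable col x) + # (Flippable col ws)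
        ≡⟨ sym (Σ-+ (λ x → b2n (T x ∧ flippable col x)) (λ x → b2n (Flippable col ws x))) ⟩
      sumFin (λ x → b2n (T x ∧ flippable col x) + b2n (Flippable col ws x))
        ≤⟨ Σ-mono pt ⟩
      # (Flippable col ((v , a) ∷ ws)) ∎
      where
      open ≤-Reasoning
      T : Fin n → Bool
      T = reach col (v , a)
      pt : ∀ x → b2n (T x ∧ flippable col x) + b2n (Flippable col ws x) ≤ b2n (Flippable col ((v , a) ∷ ws) x)
      pt x with T x in e
      ... | false = ≤-refl
      ... | true rewrite reach-clean {col} {v} {a} {ws} cln e = ≤-reflexive (+-identityʳ _)

    endsAt-zero : ∀ col T {z} → endsAt col T z ≡ 0 → ∀ {x} → end col x ≡ true → adj H z x ≡ true → T x ≡ false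
    endsAt-zero col T {z} h {x} e m = ¬true⇒false λ Tx → n≮0 (≤-trans
      (≤-reflexive (cong b2n (sym (∧-intro (∧-intro Tx e) (adj-sym m)))))
      (≤-trans (Σ-term (λ x → b2n ((T x ∧ end col x) ∧ adj H x z)) x) (≤-reflexive h)))

    b2n-pos : ∀ {b k} → k < b2n b → b ≡ true
    b2n-pos {true} _ = refl

    b2n-zero : ∀ {b} → b2n b ≡ 0 → b ≡ false
    b2n-zero {false} _ = refl

    weight-clean : ∀ col ws {z} → weight col ws z ≡ 0 → ∀ {x} → end col x ≡ true → adj H z x ≡ true → region col ws x ≡ false
    weight-clean col [] h e m = endsAt-zero col (comp col p) h e m
    weight-clean col ((v , a) ∷ ws) {z} h {x} e m
      rewrite endsAt-zero col (reach col (v , a)) {z} (m+n≡0⇒n≡0 (b2n (z == v) + b2n (adj H v z)) (m+n≡0⇒m≡0 _ h)) {x} e m =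
      weight-clean col ws (m+n≡0⇒n≡0 (b2n (z == v) + b2n (adj H v z) + endsAt col (reach col (v , a)) z) h) e m

    weight-apart : ∀ col ws {z} → weight col ws z ≡ 0 → Apart z ws
    weight-apart col [] h = []
    weight-apart col ((v , a) ∷ ws) {z} h =
      ((λ z≡v → true≢false (trans (sym (dec-true (z Fin.≟ v) z≡v)) (b2n-zero (m+n≡0⇒m≡0 (b2n (z == v)) first))))
        , b2n-zero (m+n≡0⇒n≡0 (b2n (z == v)) first))
      ∷ weight-apart col ws (m+n≡0⇒n≡0 (b2n (z == v) + b2n (adj H v z) + endsAt col (reach col (v , a)) z) h)
      where
      first : b2n (z == v) + b2n (adj H v z) ≡ 0
      first = m+n≡0⇒m≡0 _ (m+n≡0⇒m≡0 _ h)

    -- Some flippable vertex of the region has weight zero. The neighbours in the new colour of any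
    -- option there are ends by `option-end`, so weight zero keeps them out of the region.
    next : ∀ {col ws} → EdgeMin col → 5 ≤ D → Chain col ws → ∃[ w ] Candidate col w ws
    next {col} {ws} em 5≤D ch = (z , proj₁ opt-z) , candidate (proj₂ opt-z) (∧-elimˡ fl)
        (λ x m → weight-clean col ws w≡0 (end-complete {col} (option-end em (proj₂ opt-z) m)) (nbrs-adj {col} m))
        (weight-apart col ws w≡0)
      where
      found : ∃[ z ] weight col ws z < b2n (Flippable col ws z)
      found = Σ-<⇒∃< (weight col ws) (λ x → b2n (Flippable col ws x)) (Σ-weight em 5≤D ch)
      z : Fin n
      z = proj₁ found
      fl : Flippable col ws z ≡ true
      fl = b2n-pos (proj₂ found)
      w≡0 : weight col ws z ≡ 0
      w≡0 = n≤0⇒n≡0 (s≤s⁻¹ (≤-trans (proj₂ found) (b2n≤1 (Flippable col ws z))))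
      opt-z : ∃[ a ] Option col z a
      opt-z = find-option {col} (∧-elimʳ {region col ws z} fl)

    -- Handled apart from `next` because `5 ≤ D` is deduced from an existing option. Here cleanness
    -- is automatic: the root component has a single colour, and the option uses another.
    first : ∀ {col} → EdgeMin col → c < # (comp col p) → ∃[ w ] Candidate col w []
    first {col} em P>c = (z , proj₁ opt-z) , candidate o z∈ (λ x m → ¬true⇒false λ x∈ → Option.fresh o
              (trans (sym (nbrs-col {col} {z} m)) (trans (mono x∈) (sym (mono z∈))))) []
      where
      f e P : ℕ
      P = # (comp col p)
      f = # (Flippable col [])
      e = # (λ x → comp col p x ∧ end col x)
      lem : ∀ P f e → 4 * 1 + (2 * P + (4 * f + 3 * e + 6)) + 4 ≡ 4 * f + (14 + (2 * P + 3 * e))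
      lem = solve-∀
      pos : 0 < f
      -- The component has at least seven vertices and at most two ends, so `4 * f` is at least 14 -
      -- 6.
      pos = *-cancelˡ-≤ 4 (by-≤ (+-mono-≤ (*-monoʳ-≤ 2 (≤-trans (s≤s 6≤c) P>c))
        (+-mono-≤ (flippable-count em (comp col p) (cl-closed col (_== p))) (*-monoʳ-≤ 3 (comp-ends≤2 em)))) 4 (lem P f e))
      found : ∃[ z ] Flippable col [] z ≡ true
      found = #-pos (Flippable col []) pos
      z : Fin n
      z = proj₁ found
      opt-z : ∃[ a ] Option col z a
      opt-z = find-option {col} (∧-elimʳ {comp col p z} (proj₂ found))
      o : Option col z (proj₁ opt-z)
      o = proj₂ opt-z
      z∈ : comp col p z ≡ true
      z∈ = ∧-elimˡ (proj₂ found)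
      mono : ∀ {x} → comp col p x ≡ true → lookup col x ≡ lookup col p
      mono {x} e = does-sound (lookup col x ≟ lookup col p) (cl-least col (_== p) (λ x → does (lookup col x ≟ lookup col p))
        (λ x q → dec-true (lookup col x ≟ lookup col p) (cong (lookup col) (==-sound {i = x} q)))
        (λ x y q m → dec-true (lookup col y ≟ lookup col p) (trans (nbrs-col {col} {x} m) (does-sound (lookup col x ≟ lookup col p) q))) e)

    -- Termination of the alternating argument.

    option-deg : ∀ {col v a} → EdgeMin col → Option col v a → 4 ≤ D
    option-deg {col} {v} {a} em o = ≤-trans (+-mono-≤ (≤-reflexive (sym (degM≡2 o))) (option-nbrs≥2 em o))
      (≤-trans (≤-reflexive (sym (Σ-+ (λ y → b2n (M col v y)) (λ y → b2n (nbrs col v a y)))))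
        (≤-trans (Σ-mono pt) (deg≤D v)))
      where
      pt : ∀ y → b2n (M col v y) + b2n (nbrs col v a y) ≤ b2n (adj H v y)
      pt y with M col v y in e | nbrs col v a y in f
      ... | false | false = z≤n
      ... | true  | false = ≤-reflexive (cong b2n (sym (nbrs-adj {col} e)))
      ... | false | true  = ≤-reflexive (cong b2n (sym (nbrs-adj {col} {v} {a} {y} f)))
      ... | true  | true  = ⊥-elim (fresh o (trans (sym (nbrs-col {col} {v} {a} {y} f)) (nbrs-col {col} {v} e)))

    -- The root component and the reaches are nonempty and pairwise disjoint, so the region gains a
    -- vertex with every link.
    chain-length : ∀ {col ws} → Chain col ws → suc (length ws) ≤ # (region col ws)
    chain-length (root P>c) = ≤-trans (s≤s z≤n) P>c
    chain-length {col} {(v , a) ∷ ws} (link ch (candidate o ins cln ap) blocked) = begin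
      1 + suc (length ws)
        ≤⟨ +-mono-≤ (≤-trans (≤-trans (s≤s z≤n) 6≤c) blocked) (chain-length ch) ⟩
      # (reach col (v , a)) + # (region col ws)
        ≡⟨ sym (Σ-+ (λ x → b2n (reach col (v , a) x)) (λ x → b2n (region col ws x))) ⟩
      sumFin (λ x → b2n (reach col (v , a) x) + b2n (region col ws x))
        ≤⟨ Σ-mono pt ⟩
      # (region col ((v , a) ∷ ws)) ∎
      where
      open ≤-Reasoning
      pt : ∀ x → b2n (reach col (v , a) x) + b2n (region col ws x) ≤ b2n (reach col (v , a) x ∨ region col ws x)
      pt x with reach col (v , a) x in e
      ... | false = ≤-refl
      ... | true rewrite reach-clean {col} {v} {a} {ws} cln e = ≤-refl

    comp⇒big : ∀ {col v} → c < # (comp col p) → comp col p v ≡ true → big col v ≡ true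
    comp⇒big {col} {v} P>c v∈ = dec-true (c <? # (comp col v)) (≤-trans P>c
      (#-mono (λ x → cl-least col (_== p) (comp col v) (λ x q → trans (cong (comp col v) (==-sound {i = x} q)) p∈) (cl-closed col (_== v)) {x})))
      where
      p∈ : comp col v p ≡ true
      p∈ = ¬false⇒true λ e → true≢false (trans (sym (cl-contains col (_== v) (==-refl v)))
        (cl-disjoint col (_== p) (comp col v) (λ x q → trans (cong (comp col v) (==-sound {i = x} q)) e) (cl-closed col (_== v)) v∈))

    chain-root : ∀ {col ws} → Chain col ws → c < # (comp col p)
    chain-root (root h) = h
    chain-root (link ch _ _) = chain-root ch

    -- Either the chain gets longer, or a recolouring is performed and an earlier reach
    -- shrinks; the lexicographic measure is encoded as a numeral in base K.
    no-chain : ∀ m r {col w ws} → Opt col → Chain col ws → Candidate col w ws →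
      suc (length ws) + r ≡ suc n → suc (code col (w ∷ ws)) * K ^ r ≤ m → ⊥
    no-chain zero r op ch cand len h = n≮0 (≤-trans (≤-trans (m^n>0 K r) (m≤m+n (K ^ r) _)) h)
    no-chain (suc m) r {col} {v , a} {ws} op ch cand len h = split (c ≤? # (reach col (v , a)))
      where
      em : EdgeMin col
      em = opt⇒edgeMin op
      C : ℕ
      C = code col ((v , a) ∷ ws)

      extend : ∀ r → suc (length ws) + r ≡ suc n → suc C * K ^ r ≤ suc m → Chain col ((v , a) ∷ ws) → ⊥
      -- With `r` zero the extended chain would have `n + 1` links, too many for `n` vertices.
      extend zero len h ch⁺ =
        <⇒≱ (≤-trans (≤-reflexive (trans (sym len) (+-identityʳ _))) (≤-trans (n≤1+n _) (chain-length ch⁺))) (#≤n (region col ((v , a) ∷ ws)))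
      extend (suc r) len h ch⁺ = no-chain m r op ch⁺ (proj₂ found) (trans (sym (+-suc (suc (length ws)) r)) len)
        (s≤s⁻¹ (≤-trans (*-monoˡ-< (K ^ r) {{m^n≢0 K r}} smaller) (≤-trans (≤-reflexive (*-assoc (suc C) K (K ^ r))) h)))
        where
        found : ∃[ w ] Candidate col w ((v , a) ∷ ws)
        -- The current option has two neighbours in each of two colours, so `4 ≤ D`, and `D` is not
        -- 4.
        found = next em (D≢4 (option-deg em (Candidate.option cand))) ch⁺
        R : ℕ
        R = # (reach col (proj₁ found))
        smaller : suc (C * K + R) < suc C * K
        smaller = begin-strict
          suc (C * K + R)  ≡⟨ sym (+-suc (C * K) R) ⟩
          C * K + suc R    <⟨ +-monoʳ-< (C * K) (s≤s (s≤s (#≤n (reach col (proj₁ found))))) ⟩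
          C * K + K        ≡⟨ +-comm (C * K) K ⟩
          suc C * K        ∎
          where open ≤-Reasoning

      perform : # (reach col (v , a)) < c → ⊥
      -- The truncated chain has `dropped + 1` fewer links, which are returned to `r`.
      perform free = no-chain m (suc (dropped dd) + r) (opt-flip free op) (chain₁ dd) (cand₁ dd) length-eq
        (s≤s⁻¹ (≤-trans smaller h))
        where
        open Flip em (Candidate.option cand)
        open Descent em (Candidate.option cand)
        open Descended
        v∉P : comp col p v ≡ false
        -- A cheap recolouring inside the large root component would lower the cost, against
        -- optimality.
        v∉P = ¬true⇒false λ v∈P → true≢false (trans (sym (comp⇒big {col} (chain-root ch) v∈P)) (¬big-v free op))
        dd : Descended ws
        dd = descend ch v∉P (Candidate.inside cand) (Candidate.clean cand) (Candidate.apart cand)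
        C₁ C₁′ : ℕ
        C₁  = code col (w₁ dd ∷ rest dd)
        C₁′ = code col′ (w₁ dd ∷ rest dd)
        length-eq : suc (length (rest dd)) + (suc (dropped dd) + r) ≡ suc n
        length-eq = trans (lem (length (rest dd)) (dropped dd) r) (trans (cong (λ t → suc t + r) (lengths dd)) len)
          where
          lem : ∀ x y z → suc x + (suc y + z) ≡ suc (suc x + y) + z
          lem = solve-∀
        smaller : suc C₁′ * K ^ (suc (dropped dd) + r) < suc C * K ^ r
        smaller = begin-strict
          suc C₁′ * K ^ (suc (dropped dd) + r)  ≤⟨ *-monoˡ-≤ (K ^ (suc (dropped dd) + r)) (code< dd) ⟩
          C₁ * K ^ (suc (dropped dd) + r)       ≡⟨ cong (C₁ *_) (^-distribˡ-+-* K (suc (dropped dd)) r) ⟩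
          C₁ * (K * K ^ dropped dd * K ^ r)     ≡⟨ lem C₁ K (K ^ dropped dd) (K ^ r) ⟩
          C₁ * K ^ dropped dd * K * K ^ r       ≤⟨ *-monoˡ-≤ (K ^ r) (*-monoˡ-≤ K (code≤ dd)) ⟩
          code col ws * K * K ^ r               <⟨ *-monoˡ-< (K ^ r) {{m^n≢0 K r}} (s≤s (m≤m+n (code col ws * K) _)) ⟩
          suc C * K ^ r                         ∎
          where
          open ≤-Reasoning
          lem : ∀ c k x y → c * (k * x * y) ≡ c * x * k * y
          lem = solve-∀

      split : Dec (c ≤ # (reach col (v , a))) → ⊥
      split (yes blocked) = extend r len h (link ch cand blocked)
      split (no ¬blocked) = perform (≰⇒> ¬blocked)

  opt-clustering : ∀ {col} → Opt col → ∀ u → # (comp col u) ≤ c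
  opt-clustering {col} op u = ≮⇒≥ contra
    where
    open Chains u
    contra : c < # (comp col u) → ⊥
    -- The bound is the measure of the first candidate itself, with `r` equal to `n` as there is no
    -- link yet.
    contra P>c = no-chain (suc (code col (proj₁ start ∷ [])) * K ^ n) n op (root P>c) (proj₂ start) refl ≤-refl
      where
      start : ∃[ w ] Candidate col w []
      start = first (opt⇒edgeMin op) P>c

  -- Existence of an optimal colouring.

  L-inhabited : ∀ v → ∃[ a ] a ∈ L v
  L-inhabited v with L v | deg<3L v
  ... | []    | lt = ⊥-elim (n≮0 lt)
  ... | a ∷ _ | _  = a , here refl

  optimal-colouring : ∃[ col ] Opt col
  optimal-colouring with minimiser cost start (choices L)
    where
    start : Col
    start = tabulate (λ v → proj₁ (L-inhabited v))
  ... | m , m∈ , least = m , opt (valid m∈) (λ col′ lc′ → least (there (choices-complete L col′ lc′)))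
    where
    valid : ∀ {m} → m ∈ (tabulate (λ v → proj₁ (L-inhabited v)) ∷ choices L) → LCol m
    valid (here refl) v rewrite lookup∘tabulate (λ v → proj₁ (L-inhabited v)) v = proj₂ (L-inhabited v)
    valid (there m∈)  = choices-sound L _ m∈

  colouring : Σ (Fin n → ℕ) λ col → (∀ v → col v ∈ L v) × HasClustering H col c
  colouring = lookup (proj₁ best) , Opt.valid (proj₂ best) , λ u vs unique conn → ≤-trans
    (unique-length (comp (proj₁ best) u) vs unique (All.map (MonoConn-closed H (lookup (proj₁ best)) (comp (proj₁ best) u)
      (λ x y Sx e q → cl-closed (proj₁ best) (_== u) x y Sx (nbrs-intro {proj₁ best} {x} e (sym q)))
      (cl-contains (proj₁ best) (_== u) (==-refl u))) conn))
    (opt-clustering (proj₂ best) u)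
    where
    best : ∃[ col ] Opt col
    best = optimal-colouring

abstract
  clustered-colouring : (H : Graph) (L : Fin (Graph.n H) → List ℕ) (D c : ℕ) → (∀ v → Unique (L v)) →
    (∀ v → # (adj H v) < 3 * length (L v)) →
    (∀ u v → adj H u v ≡ true → # (adj H u) + # (adj H v) + 3 ≤ 3 * length (L u) + 3 * length (L v)) →
    (∀ v → # (adj H v) ≤ D) → (4 ≤ D → 5 ≤ D) → 6 ≤ c → 19 * D ≤ c + 32 →
    Σ (Fin (Graph.n H) → ℕ) λ col → (∀ v → col v ∈ L v) × HasClustering H col c
  clustered-colouring H L D c uniq h₁ h₂ h₃ h₄ h₅ h₆ = Optimal.colouring H L uniq D c h₁ h₂ h₃ h₄ h₅ h₆

-- Induced subgraphs and greedy colouring.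

∣tabulate∣ : ∀ {n} (S : Fin n → Bool) → Subset.∣ tabulate S ∣ ≡ # S
∣tabulate∣ {zero}  S = refl
∣tabulate∣ {suc n} S with S zero
... | true  = cong suc (∣tabulate∣ (λ i → S (suc i)))
... | false = ∣tabulate∣ (λ i → S (suc i))

length-filter-split : ∀ {P : ℕ → Set} (P? : ∀ a → Dec (P a)) as →
  length as ≤ length (filter (λ a → ¬? (P? a)) as) + length (filter P? as)
length-filter-split P? [] = z≤n
length-filter-split P? (a ∷ as) with P? a
... | yes _ = ≤-trans (s≤s (length-filter-split P? as)) (≤-reflexive (sym (+-suc _ _)))
... | no _  = s≤s (length-filter-split P? as)

-- Vertices outside `U` stay as isolated vertices, so lists and colourings need no reindexing.
induced : (G : Graph) → (Fin (Graph.n G) → Bool) → Graph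
induced G U = record
  { n = Graph.n G
  ; adj = λ x y → U x ∧ (U y ∧ adj G x y)
  ; sym = λ x y → trans (∧-swap (U x) (U y) (adj G x y)) (cong (λ t → U y ∧ (U x ∧ t)) (Graph.sym G x y))
  ; irrefl = λ x → trans (cong (λ t → U x ∧ (U x ∧ t)) (irrefl G x)) (zeros (U x))
  }
  where
  ∧-swap : ∀ a b c → a ∧ (b ∧ c) ≡ b ∧ (a ∧ c)
  ∧-swap true  b     c = refl
  ∧-swap false true  c = refl
  ∧-swap false false c = refl
  zeros : ∀ a → a ∧ (a ∧ false) ≡ false
  zeros true  = refl
  zeros false = refl

-- Each vertex has k + 1 colours to choose from, so one of them has been used fewer than q times.
greedy : ∀ {n} (L : Fin n → List ℕ) k q p → (∀ v → Unique (L v) × suc k ≤ length (L v)) → p ≤ q * suc k →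
  ∀ m (U : Fin n → Bool) → # U ≡ m → m ≤ p →
  Σ (Fin n → ℕ) λ col → (∀ v → col v ∈ L v) × (∀ a → # (λ x → U x ∧ does (col x ≟ a)) ≤ q)
greedy L k q p hL p≤ zero U U≡ m≤ = (λ v → proj₁ (some (L v) (proj₂ (hL v)))) , (λ v → proj₂ (some (L v) (proj₂ (hL v)))) ,
  λ a → ≤-trans (#-mono {R = U} (λ x → ∧-elimˡ {U x})) (≤-trans (≤-reflexive U≡) z≤n)
  where
  some : ∀ as → suc k ≤ length as → ∃[ a ] a ∈ as
  some (a ∷ _) _ = a , here refl
greedy {n} L k q p hL p≤ (suc m) U U≡ m≤ = col′ , col′∈L , count
  where
  found : ∃[ v ] U v ≡ true
  found = #-pos U (≤-trans (s≤s z≤n) (≤-reflexive (sym U≡)))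
  v : Fin n
  v = proj₁ found
  U′ : Fin n → Bool
  U′ = remove v U
  #U′ : # U′ ≡ m
  #U′ = suc-injective (trans (sym (#-remove v U (proj₂ found))) U≡)
  ih : Σ (Fin n → ℕ) λ col → (∀ v → col v ∈ L v) × (∀ a → # (λ x → U′ x ∧ does (col x ≟ a)) ≤ q)
  ih = greedy L k q p hL p≤ m U′ #U′ (≤-trans (n≤1+n m) m≤)
  col : Fin n → ℕ
  col = proj₁ ih
  choice : ∃[ a ] a ∈ L v × # (λ y → U′ y ∧ does (col y ≟ a)) < q
  choice = pigeonhole-colours col q (L v) (proj₁ (hL v)) U′
    (≤-trans (s≤s (≤-reflexive #U′)) (≤-trans m≤ (≤-trans p≤ (*-monoʳ-≤ q (proj₂ (hL v))))))
  a : ℕ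
  a = proj₁ choice
  col′ : Fin n → ℕ
  col′ x = if x == v then a else col x
  col′∈L : ∀ x → col′ x ∈ L x
  col′∈L x with x Fin.≟ v
  ... | yes refl = proj₁ (proj₂ choice)
  ... | no _ = proj₁ (proj₂ ih) x
  count : ∀ b → # (λ x → U x ∧ does (col′ x ≟ b)) ≤ q
  count b = split (a ≟ b)
    where
    used : Fin n → Bool
    used x = U′ x ∧ does (col x ≟ b)
    split : Dec (a ≡ b) → # (λ x → U x ∧ does (col′ x ≟ b)) ≤ q
    split (yes refl) = ≤-trans (#-mono sub) (≤-trans
      (≤-reflexive (#-insert v used (cong (_∧ does (col v ≟ a)) (remove-at v U)))) (proj₂ (proj₂ choice)))
      where
      sub : ∀ x → U x ∧ does (col′ x ≟ a) ≡ true → insert v used x ≡ true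
      sub x e with x Fin.≟ v
      ... | yes refl = ∨-introʳ {(U x ∧ false) ∧ does (col x ≟ a)} refl
      ... | no _ = ∨-introˡ (∧-intro (∧-intro (∧-elimˡ {U x} e) refl) (∧-elimʳ {U x} e))
    split (no a≢b) = ≤-trans (#-mono sub) (proj₂ (proj₂ ih) b)
      where
      sub : ∀ x → U x ∧ does (col′ x ≟ b) ≡ true → used x ≡ true
      sub x e with x Fin.≟ v
      ... | yes refl = ⊥-elim (a≢b (does-sound (a ≟ b) (∧-elimʳ {U x} e)))
      ... | no _ = ∧-intro (∧-intro (∧-elimˡ {U x} e) refl) (∧-elimʳ {U x} e)

-- Extracting the core from the density hypothesis.

module Sparse (G : Graph) (k : ℕ) where

  private
    n : ℕ
    n = Graph.n G

  VSet : Set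
  VSet = Fin n → Bool

  deg : VSet → Fin n → ℕ
  deg S x = # (λ y → S y ∧ adj G x y)

  total : VSet → VSet → ℕ
  total U A = sumFin (λ x → b2n (A x) * deg U x)

  inner-remove : ∀ A v → inner (adj G) A ≤ inner (adj G) (remove v A) + 2 * deg A v
  inner-remove A v = begin
    inner (adj G) A
      ≤⟨ Σ-mono (λ x → Σ-mono (λ y → pt x y)) ⟩
    sumFin (λ x → sumFin (λ y → old x y + (row x y + col x y)))
      ≡⟨ ΣΣ-+ old (λ x y → row x y + col x y) ⟩
    inner (adj G) (remove v A) + sumFin (λ x → sumFin (λ y → row x y + col x y))
      ≡⟨ cong (inner (adj G) (remove v A) +_) (trans (ΣΣ-+ row col) (cong₂ _+_ rows cols)) ⟩
    inner (adj G) (remove v A) + 2 * deg A v ∎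
    where
    open ≤-Reasoning
    old row col : Fin n → Fin n → ℕ
    old x y = b2n (remove v A x ∧ (remove v A y ∧ adj G x y))
    row x y = b2n (x == v) * b2n (A y ∧ adj G v y)
    col x y = b2n (y == v) * b2n (A x ∧ adj G v x)
    rows : sumFin (λ x → sumFin (row x)) ≡ deg A v
    rows = trans (Σ-cong (λ x → Σ-*ˡ (b2n (x == v)) (λ y → b2n (A y ∧ adj G v y)))) (Σ-point v (λ _ → deg A v))
    cols : sumFin (λ x → sumFin (col x)) ≡ deg A v + 0
    cols = trans (Σ-cong (λ x → Σ-point v (λ _ → b2n (A x ∧ adj G v x)))) (sym (+-identityʳ _))
    pt : ∀ x y → b2n (A x ∧ (A y ∧ adj G x y)) ≤ old x y + (row x y + col x y)
    pt x y with x Fin.≟ v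
    ... | yes refl = ≤-trans (b2n-mono {b = A y ∧ adj G x y} (∧-elimʳ {A x}))
      (≤-trans (≤-reflexive (sym (+-identityʳ (b2n (A y ∧ adj G x y))))) (≤-trans (m≤m+n (b2n (A y ∧ adj G x y) + 0) (col x y))
        (m≤n+m _ (b2n ((A x ∧ not true) ∧ ((A y ∧ not (y == x)) ∧ adj G x y))))))
    ... | no _ with y Fin.≟ v
    ...   | yes refl = ≤-trans (b2n-mono {b = A x ∧ adj G y x} (λ e → ∧-intro (∧-elimˡ e) (trans (Graph.sym G y x) (∧-elimʳ {A y} (∧-elimʳ {A x} e)))))
      (≤-trans (≤-reflexive (sym (+-identityʳ (b2n (A x ∧ adj G y x))))) (m≤n+m (b2n (A x ∧ adj G y x) + 0) (b2n ((A x ∧ true) ∧ ((A y ∧ not true) ∧ adj G x y)))))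
    ...   | no _ with A x | A y
    ...     | false | _     = z≤n
    ...     | true  | false = z≤n
    ...     | true  | true  = m≤m+n (b2n (adj G x y)) 0

  total-remove : ∀ U A v → A v ≡ true → total U (remove v A) + deg U v ≤ total U A
  total-remove U A v Av = ≤-trans (≤-reflexive (trans
      (cong (total U (remove v A) +_) (sym (Σ-point v (deg U)))) (sym (Σ-+ (λ x → b2n (remove v A x) * deg U x) (λ x → b2n (x == v) * deg U x)))))
    (Σ-mono pt)
    where
    pt : ∀ x → b2n (remove v A x) * deg U x + b2n (x == v) * deg U x ≤ b2n (A x) * deg U x
    pt x with x Fin.≟ v
    ... | yes refl rewrite Av = ≤-refl
    ... | no _ with A x
    ...   | true  = ≤-reflexive (+-identityʳ _)
    ...   | false = ≤-refl

  deg-remove : ∀ A {u v} → A v ≡ true → adj G u v ≡ true → deg (remove v A) u < deg A u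
  deg-remove A {u} {v} Av uv = #-mono-< (λ x e → ∧-intro (∧-elimˡ (∧-elimˡ e)) (∧-elimʳ {remove v A x} e)) v
    (cong (_∧ adj G u v) (remove-at v A)) (∧-intro Av uv)

  -- With e counting edges, this is 4 e(A) + 3 e(A, U - A) < 3k |A| for `A` inside `U`. For `A = U`
  -- it says that the average degree is below 3k/2.
  Dense : VSet → VSet → Set
  Dense U A = 3 * total U A < inner (adj G) A + 3 * k * # A

  -- A dense set from which no vertex and no adjacent pair can be removed by the two density steps.
  -- With `k - (deg U v - deg core v)` colours left at `v`, `vertex` and `edge` become the degree
  -- conditions of `clustered-colouring`.
  record Core (U : VSet) : Set where
    field
      core     : VSet
      core⊆    : ∀ x → core x ≡ true → U x ≡ true
      nonempty : ∃[ x ] core x ≡ true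
      vertex   : ∀ v → core v ≡ true → 3 * deg U v < 2 * deg core v + 3 * k
      edge     : ∀ u v → core u ≡ true → core v ≡ true → adj G u v ≡ true →
        3 * deg U u + 3 * deg U v + 2 < 2 * deg core u + 2 * deg core v + 6 * k

  -- Removing `v` costs `2 * deg A v + 3 * k` on the right and saves `3 * deg U v` on the left.
  dense-vertex : ∀ U A v → Dense U A → A v ≡ true → 2 * deg A v + 3 * k ≤ 3 * deg U v → Dense U (remove v A)
  dense-vertex U A v dense Av h = by-≤
    (+-mono-≤ dense (+-mono-≤ (inner-remove A v) (+-mono-≤ (*-monoʳ-≤ 3 (total-remove U A v Av)) h))) 0
    (trans (cong (λ t → suc (3 * total U (remove v A)) + (inner (adj G) A + 3 * k * t +
          (inner (adj G) (remove v A) + 2 * deg A v + (3 * total U A + 3 * deg U v))) + 0) (#-remove v A Av))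
      (lem (total U A) (total U (remove v A)) (inner (adj G) A) (inner (adj G) (remove v A)) (# (remove v A)) (deg A v) (deg U v) k))
    where
    lem : ∀ s s′ i i′ m a d k →
      suc (3 * s′) + (i + 3 * k * suc m + (i′ + 2 * a + (3 * s + 3 * d))) + 0 ≡
      i′ + 3 * k * m + (suc (3 * s) + (i + (3 * (s′ + d) + (2 * a + 3 * k))))
    lem = solve-∀

  -- Once `v` is gone, `u` has one neighbour fewer in the set; this yields the additional 2.
  dense-edge : ∀ U A u v → Dense U A → A u ≡ true → A v ≡ true → adj G u v ≡ true →
    2 * deg A u + 2 * deg A v + 6 * k ≤ 3 * deg U u + 3 * deg U v + 2 → Dense U (remove u (remove v A))
  dense-edge U A u v dense Au Av uv h = by-≤
    (+-mono-≤ dense (+-mono-≤ (inner-remove A v) (+-mono-≤ (inner-remove A₁ u)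
      (+-mono-≤ (*-monoʳ-≤ 3 (total-remove U A v Av)) (+-mono-≤ (*-monoʳ-≤ 3 (total-remove U A₁ u A₁u))
      (+-mono-≤ (*-monoʳ-≤ 2 (deg-remove A Av uv)) h)))))) 0
    (trans (cong (λ t → suc (3 * total U A₂) + (inner (adj G) A + 3 * k * t + (inner (adj G) A₁ + 2 * deg A v +
          (inner (adj G) A₂ + 2 * deg A₁ u + (3 * total U A + (3 * total U A₁ + (2 * deg A u + (3 * deg U u + 3 * deg U v + 2))))))) + 0)
          (trans (#-remove v A Av) (cong suc (#-remove u A₁ A₁u))))
      (lem (total U A) (total U A₁) (total U A₂) (inner (adj G) A) (inner (adj G) A₁) (inner (adj G) A₂) (# A₂)
        (deg A v) (deg A u) (deg A₁ u) (deg U v) (deg U u) k))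
    where
    A₁ A₂ : VSet
    A₁ = remove v A
    A₂ = remove u A₁
    u≢v : u ≢ v
    u≢v refl = true≢false (trans (sym uv) (irrefl G u))
    A₁u : A₁ u ≡ true
    A₁u = remove-off A u≢v Au
    lem : ∀ s s₁ s₂ i i₁ i₂ m av au a₁ dv du k →
      suc (3 * s₂) + (i + 3 * k * suc (suc m) + (i₁ + 2 * av + (i₂ + 2 * a₁ + (3 * s + (3 * s₁ + (2 * au + (3 * du + 3 * dv + 2))))))) + 0 ≡
      i₂ + 3 * k * m + (suc (3 * s) + (i + (i₁ + (3 * (s₁ + dv) + (3 * (s₂ + du) + (2 * suc a₁ + (2 * au + 2 * av + 6 * k)))))))
    lem = solve-∀

  dense-nonempty : ∀ U A → Dense U A → ∃[ x ] A x ≡ true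
  dense-nonempty U A dense with Fin.any? (λ x → A x Bool.≟ true)
  ... | yes p = p
  ... | no none = ⊥-elim (n≮0 (≤-trans dense (≤-reflexive (cong₂ _+_ inner≡0 (trans (cong (3 * k *_) #≡0) (*-zeroʳ (3 * k)))))))
    where
    empty : ∀ x → A x ≡ false
    empty x = ¬true⇒false λ e → none (x , e)
    #≡0 : # A ≡ 0
    #≡0 = trans (#-cong empty) (Σ-zero n)
    inner≡0 : inner (adj G) A ≡ 0
    inner≡0 = trans (Σ-cong (λ x → trans (Σ-cong (λ y → cong (λ t → b2n (t ∧ (A y ∧ adj G x y))) (empty x))) (Σ-zero n))) (Σ-zero n)

  -- Each removal preserves density and lowers the size, so the process stops; the result is
  -- nonempty because the strict inequality fails for the empty set.
  find-core : ∀ U m A → # A ≤ m → (∀ x → A x ≡ true → U x ≡ true) → Dense U A → Core U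
  find-core U m A #A≤m A⊆U dense
    with Fin.any? (λ v → (A v Bool.≟ true) ×-dec (2 * deg A v + 3 * k ≤? 3 * deg U v))
  ... | yes (v , Av , h) = shrink m #A≤m
    where
    shrink : ∀ m → # A ≤ m → Core U
    shrink zero le = ⊥-elim (n≮0 (≤-trans (≤-reflexive (sym (#-remove v A Av))) le))
    shrink (suc m) le = find-core U m (remove v A) (s≤s⁻¹ (≤-trans (≤-reflexive (sym (#-remove v A Av))) le))
      (λ x e → A⊆U x (∧-elimˡ e)) (dense-vertex U A v dense Av h)
  ... | no none
    with Fin.any? (λ u → Fin.any? (λ v → (A u Bool.≟ true) ×-dec ((A v Bool.≟ true) ×-dec ((adj G u v Bool.≟ true) ×-dec
           (2 * deg A u + 2 * deg A v + 6 * k ≤? 3 * deg U u + 3 * deg U v + 2)))))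
  ...   | no none₂ = record
    { core = A ; core⊆ = A⊆U ; nonempty = dense-nonempty U A dense
    ; vertex = λ v Av → ≰⇒> λ h → none (v , Av , h)
    ; edge = λ u v Au Av uv → ≰⇒> λ h → none₂ (u , v , Au , Av , uv , h)
    }
  ...   | yes (u , v , Au , Av , uv , h) = shrink m #A≤m
    where
    smaller : # (remove u (remove v A)) < # A
    smaller = ≤-trans (s≤s (#-mono {R = remove v A} (λ x → ∧-elimˡ {remove v A x}))) (≤-reflexive (sym (#-remove v A Av)))
    shrink : ∀ m → # A ≤ m → Core U
    shrink zero le = ⊥-elim (n≮0 (≤-trans smaller le))
    shrink (suc m) le = find-core U m (remove u (remove v A)) (s≤s⁻¹ (≤-trans smaller le))
      (λ x e → A⊆U x (∧-elimˡ (∧-elimˡ e))) (dense-edge U A u v dense Au Av uv h)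

  inner≡total : ∀ U → inner (adj G) U ≡ total U U
  inner≡total U = Σ-cong pt
    where
    pt : ∀ x → # (λ y → U x ∧ (U y ∧ adj G x y)) ≡ b2n (U x) * deg U x
    pt x with U x
    ... | true  = sym (+-identityʳ _)
    ... | false = Σ-zero n

  induced-subgraph : VSet → Subgraph G
  induced-subgraph U = record
    { verts = tabulate U
    ; edges = adj (induced G U)
    ; e-sym = Graph.sym (induced G U)
    ; e-inG = λ u v e → ∧-elimʳ {U v} (∧-elimʳ {U u} e)
    ; e-inS = λ u v e → mem (∧-elimˡ e) , mem (∧-elimˡ (∧-elimʳ {U u} e))
    }
    where
    mem : ∀ {u} → U u ≡ true → u Subset.∈ tabulate U
    mem {u} e = lookup⇒[]= u (tabulate U) (trans (lookup∘tabulate U u) e)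

  -- `U` itself is dense: `total U U` is the degree sum of the induced subgraph, to which the
  -- hypothesis applies.
  core-exists : ∀ {n0} → MadLess G n0 (3 * k) 2 → ∀ U → n0 ≤ # U → Core U
  core-exists mad U n0≤ = find-core U n U (#≤n U) (λ _ e → e)
    (subst (λ t → 3 * t < inner (adj G) U + 3 * k * # U) (inner≡total U) (by-≤ small 0 (lem (inner (adj G) U) (3 * k * # U))))
    where
    small : 2 * inner (adj G) U < 3 * k * # U
    small = subst (λ t → 2 * inner (adj G) U < 3 * k * t) (∣tabulate∣ U)
      (proj₂ mad (induced-subgraph U) (≤-trans n0≤ (≤-reflexive (sym (∣tabulate∣ U)))))
    lem : ∀ i s → suc (3 * i) + s + 0 ≡ i + s + suc (2 * i)
    lem = solve-∀

-- Colouring vertex sets by extension over the core.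

module Choosing (G : Graph) (k′ : ℕ) (L : Fin (Graph.n G) → List ℕ)
  (hL : ∀ v → Unique (L v) × suc k′ ≤ length (L v)) (c : ℕ) (57k≤c : 57 * k′ + 6 ≤ c) where

  private
    n : ℕ
    n = Graph.n G

    k : ℕ
    k = suc k′

  open Sparse G k

  Coloured : VSet → Set
  Coloured U = Σ (Fin n → ℕ) λ col → (∀ v → col v ∈ L v) × HasClustering (induced G U) col c

  1≤c : 1 ≤ c
  1≤c = ≤-trans (≤-trans (s≤s z≤n) (m≤n+m 6 (57 * k′))) 57k≤c

  -- A greedy colouring uses each colour at most `c` times on `U`, and a component inside `U` has
  -- only one colour.
  few-vertices : ∀ {p} → p ≤ c * k → ∀ U → # U ≤ p → Coloured U
  few-vertices {p} p≤ U #U≤p = col , proj₁ (proj₂ g) , clustered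
    where
    g : Σ (Fin n → ℕ) λ col → (∀ v → col v ∈ L v) × (∀ a → # (λ x → U x ∧ does (col x ≟ a)) ≤ c)
    g = greedy L k′ c p hL p≤ (# U) U refl #U≤p
    col : Fin n → ℕ
    col = proj₁ g
    clustered : HasClustering (induced G U) col c
    clustered u vs unique conn with U u in Uu
    ... | true = ≤-trans (unique-length S vs unique (All.map (MonoConn-closed (induced G U) col S closed
          (∧-intro Uu (dec-true (col u ≟ col u) refl))) conn)) (proj₂ (proj₂ g) (col u))
      where
      S : VSet
      S x = U x ∧ does (col x ≟ col u)
      closed : ∀ x y → S x ≡ true → U x ∧ (U y ∧ adj G x y) ≡ true → col x ≡ col y → S y ≡ true
      closed x y Sx e q = ∧-intro (∧-elimˡ (∧-elimʳ {U x} e))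
        (dec-true (col y ≟ col u) (trans (sym q) (does-sound (col x ≟ col u) (∧-elimʳ {U x} Sx))))
    -- A vertex outside `U` is isolated and forms a component by itself.
    ... | false = ≤-trans (unique-length (_== u) vs unique (All.map (MonoConn-closed (induced G U) col (_== u) closed
          (==-refl u)) conn)) (≤-trans (≤-reflexive (#-single u)) 1≤c)
      where
      closed : ∀ x y → (x == u) ≡ true → U x ∧ (U y ∧ adj G x y) ≡ true → col x ≡ col y → (y == u) ≡ true
      closed x y xu e q with ==-sound {i = x} {u} xu
      ... | refl = ⊥-elim (true≢false (trans (sym (∧-elimˡ e)) Uu))

  module Extend (U : VSet) (co : Core U) (coloured : Coloured (λ x → U x ∧ not (Core.core co x))) where

    open Core co renaming (core to A; core⊆ to A⊆U)

    W : VSet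
    W x = U x ∧ not (A x)

    col₀ : Fin n → ℕ
    col₀ = proj₁ coloured

    Forbidden : Fin n → ℕ → Set
    Forbidden v a = ∃[ u ] W u ∧ adj G v u ≡ true × col₀ u ≡ a

    forbidden? : ∀ v a → Dec (Forbidden v a)
    forbidden? v a = Fin.any? (λ u → (W u ∧ adj G v u Bool.≟ true) ×-dec (col₀ u ≟ a))

    allowed : Fin n → List ℕ
    allowed v = filter (λ a → ¬? (forbidden? v a)) (L v)

    -- Vertices outside the core are isolated in the graph H and keep their colour.
    L′ : Fin n → List ℕ
    L′ v = if A v then allowed v else (col₀ v ∷ [])

    L′-unique : ∀ v → Unique (L′ v)
    L′-unique v with A v
    ... | true  = filter⁺ (λ a → ¬? (forbidden? v a)) (proj₁ (hL v))
    ... | false = [] ∷ []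

    H : Graph
    H = induced G A

    -- With more forbidden colours than outside neighbours, pigeonhole with `q` equal to 1 would
    -- give a forbidden colour that none of these neighbours has.
    forbidden-few : ∀ v → length (filter (forbidden? v) (L v)) ≤ # (λ y → W y ∧ adj G v y)
    forbidden-few v = ≮⇒≥ contra
      where
      Q : VSet
      Q y = W y ∧ adj G v y
      contra : # Q < length (filter (forbidden? v) (L v)) → ⊥
      contra lt = <⇒≱ (proj₂ (proj₂ found)) hit
        where
        found : ∃[ a ] a ∈ filter (forbidden? v) (L v) × # (λ y → Q y ∧ does (col₀ y ≟ a)) < 1
        found = pigeonhole-colours col₀ 1 (filter (forbidden? v) (L v)) (filter⁺ (forbidden? v) (proj₁ (hL v))) Q
          (≤-trans lt (≤-reflexive (sym (+-identityʳ _))))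
        a : ℕ
        a = proj₁ found
        forb : Forbidden v a
        forb = proj₂ (∈-filter⁻ (forbidden? v) {xs = L v} (proj₁ (proj₂ found)))
        hit : 0 < # (λ y → Q y ∧ does (col₀ y ≟ a))
        hit = ≤-trans (≤-reflexive (cong b2n (sym (∧-intro (proj₁ (proj₂ forb)) (dec-true (col₀ (proj₁ forb) ≟ a) (proj₂ (proj₂ forb)))))))
          (Σ-term (λ y → b2n (Q y ∧ does (col₀ y ≟ a))) (proj₁ forb))

    deg-split : ∀ v → deg U v ≡ deg A v + # (λ y → W y ∧ adj G v y)
    deg-split v = trans (#-split (λ y → U y ∧ adj G v y) A) (cong₂ _+_ (#-cong inA) (#-cong inW))
      where
      inA : ∀ y → (U y ∧ adj G v y) ∧ A y ≡ A y ∧ adj G v y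
      inA y = ⇔-≡ (λ e → ∧-intro (∧-elimʳ {U y ∧ adj G v y} e) (∧-elimʳ {U y} (∧-elimˡ e)))
        (λ e → ∧-intro (∧-intro (A⊆U y (∧-elimˡ e)) (∧-elimʳ {A y} e)) (∧-elimˡ e))
      inW : ∀ y → (U y ∧ adj G v y) ∧ not (A y) ≡ W y ∧ adj G v y
      inW y with U y | adj G v y | A y
      ... | false | _     | _     = refl
      ... | true  | false | true  = refl
      ... | true  | false | false = refl
      ... | true  | true  | true  = refl
      ... | true  | true  | false = refl

    -- At most `deg U v - deg A v` colours are lost, one for each neighbour outside the core.
    allowed-length : ∀ v → k + deg A v ≤ length (allowed v) + deg U v
    allowed-length v = begin
      k + deg A v
        ≤⟨ +-monoˡ-≤ (deg A v) (≤-trans (proj₂ (hL v)) (≤-trans (length-filter-split (forbidden? v) (L v))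
             (+-monoʳ-≤ (length (allowed v)) (forbidden-few v)))) ⟩
      length (allowed v) + w + deg A v
        ≡⟨ lem (length (allowed v)) w (deg A v) ⟩
      length (allowed v) + (deg A v + w)
        ≡⟨ cong (length (allowed v) +_) (sym (deg-split v)) ⟩
      length (allowed v) + deg U v ∎
      where
      open ≤-Reasoning
      w : ℕ
      w = # (λ y → W y ∧ adj G v y)
      lem : ∀ l w a → l + w + a ≡ l + (a + w)
      lem = solve-∀

    L′-core : ∀ {v} → A v ≡ true → L′ v ≡ allowed v
    L′-core Av rewrite Av = refl

    L′-off : ∀ {v} → A v ≡ false → L′ v ≡ col₀ v ∷ []
    L′-off Av rewrite Av = refl

    deg-core : ∀ {v} → A v ≡ true → # (adj H v) ≡ deg A v
    deg-core {v} Av = #-cong (λ y → cong (_∧ (A y ∧ adj G v y)) Av)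

    deg-off : ∀ {v} → A v ≡ false → # (adj H v) ≡ 0
    deg-off {v} Av = trans (#-cong (λ y → cong (_∧ (A y ∧ adj G v y)) Av)) (Σ-zero n)

    deg<3L′ : ∀ v → # (adj H v) < 3 * length (L′ v)
    deg<3L′ v = split (A v) refl
      where
      arith : ∀ a l u k → suc a + (2 * a + 3 * k + 3 * (l + u)) + 0 ≡ 3 * l + (suc (3 * u) + 3 * (k + a))
      arith = solve-∀
      split : ∀ b → A v ≡ b → # (adj H v) < 3 * length (L′ v)
      split true Av rewrite deg-core Av | L′-core Av =
        by-≤ (+-mono-≤ (vertex v Av) (*-monoʳ-≤ 3 (allowed-length v))) 0 (arith (deg A v) (length (allowed v)) (deg U v) k)
      split false Av rewrite deg-off Av | L′-off Av = s≤s z≤n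

    tight-independent : ∀ u v → adj H u v ≡ true →
      # (adj H u) + # (adj H v) + 3 ≤ 3 * length (L′ u) + 3 * length (L′ v)
    tight-independent u v e = go (∧-elimˡ e) (∧-elimˡ (∧-elimʳ {A u} e)) (∧-elimʳ {A v} (∧-elimʳ {A u} e))
      where
      arith : ∀ a b l m x y k → a + b + 3 + (2 * a + 2 * b + 6 * k + (3 * (l + x) + 3 * (m + y))) + 0 ≡
        3 * l + 3 * m + (suc (3 * x + 3 * y + 2) + (3 * (k + a) + 3 * (k + b)))
      arith = solve-∀
      go : A u ≡ true → A v ≡ true → adj G u v ≡ true →
        # (adj H u) + # (adj H v) + 3 ≤ 3 * length (L′ u) + 3 * length (L′ v)
      go Au Av uv rewrite deg-core Au | deg-core Av | L′-core Au | L′-core Av =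
        by-≤ (+-mono-≤ (edge u v Au Av uv) (+-mono-≤ (*-monoʳ-≤ 3 (allowed-length u)) (*-monoʳ-≤ 3 (allowed-length v)))) 0
          (arith (deg A u) (deg A v) (length (allowed u)) (length (allowed v)) (deg U u) (deg U v) k)

    D : ℕ
    D = 3 * k′ + 2

    -- The degree in the core is at most that in `U`, so `vertex` forces `deg A v < 3 * k`, and `D`
    -- is 3k - 1.
    deg≤D : ∀ v → # (adj H v) ≤ D
    deg≤D v = split (A v) refl
      where
      arith : ∀ a u k′ w → u ≡ a + w → a + (2 * a + 3 * suc k′) + 3 * w ≡ 3 * k′ + 2 + suc (3 * u)
      arith a .(a + w) k′ w refl = lem a k′ w
        where
        lem : ∀ a k′ w → a + (2 * a + 3 * suc k′) + 3 * w ≡ 3 * k′ + 2 + suc (3 * (a + w))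
        lem = solve-∀
      split : ∀ b → A v ≡ b → # (adj H v) ≤ D
      split true Av rewrite deg-core Av = by-≤ (vertex v Av) (3 * # (λ y → W y ∧ adj G v y))
        (arith (deg A v) (deg U v) k′ (# (λ y → W y ∧ adj G v y)) (deg-split v))
      split false Av rewrite deg-off Av = z≤n

    D≢4 : 4 ≤ D → 5 ≤ D
    D≢4 = lem k′
      where
      lem : ∀ k → 4 ≤ 3 * k + 2 → 5 ≤ 3 * k + 2
      lem zero (s≤s (s≤s ()))
      lem (suc k) _ = +-monoˡ-≤ 2 (*-monoʳ-≤ 3 {1} {suc k} (s≤s z≤n))

    -- For `D` equal to 3k - 1, the number 19 D - 32 is 57k - 51, the constant of the bound.
    19D≤c+32 : 19 * D ≤ c + 32
    19D≤c+32 = ≤-trans (≤-reflexive (lem k′)) (+-monoˡ-≤ 32 57k≤c)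
      where
      lem : ∀ k → 19 * (3 * k + 2) ≡ 57 * k + 6 + 32
      lem = solve-∀

    best : Σ (Fin n → ℕ) λ col → (∀ v → col v ∈ L′ v) × HasClustering H col c
    best = clustered-colouring H L′ D c L′-unique deg<3L′ tight-independent deg≤D D≢4
      (≤-trans (m≤n+m 6 (57 * k′)) 57k≤c) 19D≤c+32

    col₁ : Fin n → ℕ
    col₁ = proj₁ best

    col₁∈L′ : ∀ v → col₁ v ∈ L′ v
    col₁∈L′ = proj₁ (proj₂ best)

    col₁-off : ∀ {v} → A v ≡ false → col₁ v ≡ col₀ v
    col₁-off {v} Av = only (subst (col₁ v ∈_) (L′-off Av) (col₁∈L′ v))
      where
      only : ∀ {a b} → a ∈ b ∷ [] → a ≡ b
      only (here e) = e

    col₁-core : ∀ {v} → A v ≡ true → col₁ v ∈ L v × ¬ Forbidden v (col₁ v)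
    col₁-core {v} Av = ∈-filter⁻ (λ a → ¬? (forbidden? v a)) {xs = L v} (subst (col₁ v ∈_) (L′-core Av) (col₁∈L′ v))

    col₁∈L : ∀ v → col₁ v ∈ L v
    col₁∈L v = split (A v) refl
      where
      split : ∀ b → A v ≡ b → col₁ v ∈ L v
      split true  Av = proj₁ (col₁-core Av)
      split false Av = subst (_∈ L v) (sym (col₁-off Av)) (proj₁ (proj₂ coloured) v)

    -- The colours of outside neighbours were removed from the list of `x`, so a monochromatic edge
    -- cannot leave the core. Components therefore stay on one side.
    no-crossing : ∀ {x y} → A x ≡ true → U y ≡ true → adj G x y ≡ true → col₁ x ≡ col₁ y → A y ≡ true
    no-crossing {x} {y} Ax Uy xy q = split (A y) refl
      where
      split : ∀ b → A y ≡ b → A y ≡ true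
      split true  Ay = Ay
      split false Ay = ⊥-elim (proj₂ (col₁-core Ax)
        (y , ∧-intro (∧-intro Uy (cong not Ay)) xy , trans (sym (col₁-off Ay)) (sym q)))

    outside : ∀ {u v} → A u ≡ false → MonoConn (induced G U) col₁ u v → A v ≡ false × MonoConn (induced G W) col₀ u v
    outside Au here = Au , here
    outside {u} {v} Au (step {w} c e q) = Av , step (proj₂ ih) edge′ (trans (sym (col₁-off (proj₁ ih))) (trans q (col₁-off Av)))
      where
      ih : A w ≡ false × MonoConn (induced G W) col₀ u w
      ih = outside Au c
      Uw : U w ≡ true
      Uw = ∧-elimˡ e
      Uv : U v ≡ true
      Uv = ∧-elimˡ (∧-elimʳ {U w} e)
      wv : adj G w v ≡ true
      wv = ∧-elimʳ {U v} (∧-elimʳ {U w} e)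
      Av : A v ≡ false
      Av = ¬true⇒false λ Av → true≢false (trans (sym (no-crossing Av Uw (trans (Graph.sym G v w) wv) (sym q))) (proj₁ ih))
      edge′ : W w ∧ (W v ∧ adj G w v) ≡ true
      edge′ = ∧-intro (∧-intro Uw (cong not (proj₁ ih))) (∧-intro (∧-intro Uv (cong not Av)) wv)

    inside : ∀ {u v} → A u ≡ true → MonoConn (induced G U) col₁ u v → A v ≡ true × MonoConn H col₁ u v
    inside Au here = Au , here
    inside {u} {v} Au (step {w} c e q) = Av , step (proj₂ ih) (∧-intro (proj₁ ih) (∧-intro Av wv)) q
      where
      ih : A w ≡ true × MonoConn H col₁ u w
      ih = inside Au c
      wv : adj G w v ≡ true
      wv = ∧-elimʳ {U v} (∧-elimʳ {U w} e)
      Av : A v ≡ true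
      Av = no-crossing (proj₁ ih) (∧-elimˡ (∧-elimʳ {U w} e)) wv q

    clustered : HasClustering (induced G U) col₁ c
    clustered u vs unique conn = split (A u) refl
      where
      split : ∀ b → A u ≡ b → length vs ≤ c
      split true  Au = proj₂ (proj₂ best) u vs unique (All.map (λ m → proj₂ (inside Au m)) conn)
      split false Au = proj₂ (proj₂ coloured) u vs unique (All.map (λ m → proj₂ (outside Au m)) conn)

    result : Coloured U
    result = col₁ , col₁∈L , clustered

  -- Induction on a bound for the size of `U`; the core is nonempty, so the set outside it is
  -- smaller.
  colour : ∀ {p} → MadLess G (suc p) (3 * k) 2 → p ≤ c * k → ∀ m U → # U ≤ m → Coloured U
  colour {p} mad p≤ m U #U≤m = split (suc p ≤? # U)
    where
    split : Dec (suc p ≤ # U) → Coloured U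
    split (no few) = few-vertices p≤ U (s≤s⁻¹ (≰⇒> few))
    split (yes many) = large m #U≤m
      where
      co : Core U
      co = core-exists mad U many
      open Core co
      fewer : # (λ x → U x ∧ not (core x)) < # U
      fewer = #-mono-< (λ x → ∧-elimˡ {U x}) (proj₁ nonempty)
        (trans (cong (λ t → U (proj₁ nonempty) ∧ not t) (proj₂ nonempty)) (∧-zeroʳ (U (proj₁ nonempty)))) (core⊆ _ (proj₂ nonempty))
      large : ∀ m → # U ≤ m → Coloured U
      large zero le = ⊥-elim (n≮0 (≤-trans fewer le))
      large (suc m) le = Extend.result U co (colour mad p≤ m (λ x → U x ∧ not (core x)) (s≤s⁻¹ (≤-trans fewer le)))

-- Rounding up, and the clustering bound for the whole graph.

≤-ceilDiv : ∀ p k → p ≤ ceilDiv p (suc k) * suc k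
≤-ceilDiv p k = +-cancelʳ-≤ k p _ (begin
  p + k                                                    ≡⟨ m≡m%n+[m/n]*n (p + k) (suc k) ⟩
  (p + k) % suc k + ceilDiv p (suc k) * suc k              ≤⟨ +-monoˡ-≤ _ (s≤s⁻¹ (m%n<n (p + k) (suc k))) ⟩
  k + ceilDiv p (suc k) * suc k                            ≡⟨ +-comm k _ ⟩
  ceilDiv p (suc k) * suc k + k                            ∎)
  where open ≤-Reasoning

theorem8 : (d n0 k : ℕ) → 1 ≤ n0 → .{{_ : NonZero k}} → (G : Graph) →
    MadLess G n0 (3 * k) 2 →
    ChoosableClustered G k (ceilDiv (n0 ∸ 1) k ⊔ (57 * k ∸ 51))
theorem8 d (suc p) (suc k) 1≤n0 G mad (L , hL) = proj₁ coloured , proj₁ (proj₂ coloured) ,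
  λ u vs unique conn → proj₂ (proj₂ coloured) u vs unique (All.map whole conn)
  where
  c : ℕ
  c = ceilDiv p (suc k) ⊔ (57 * suc k ∸ 51)
  57k≤c : 57 * k + 6 ≤ c
  57k≤c = ≤-trans (≤-reflexive (sym (trans (cong (_∸ 51) (lem k)) (m+n∸n≡m (57 * k + 6) 51)))) (m≤n⊔m (ceilDiv p (suc k)) _)
    where
    lem : ∀ k → 57 * suc k ≡ 57 * k + 6 + 51
    lem = solve-∀
  open Choosing G k L hL c 57k≤c
  coloured : Coloured (λ _ → true)
  coloured = colour mad (≤-trans (≤-ceilDiv p k) (*-monoˡ-≤ (suc k) (m≤m⊔n (ceilDiv p (suc k)) _))) (Graph.n G) (λ _ → true) (#≤n _)
  whole : ∀ {u v} → MonoConn G (proj₁ coloured) u v → MonoConn (induced G (λ _ → true)) (proj₁ coloured) u v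
  whole here = here
  -- Adjacency in the subgraph induced by all vertices computes to that of `G`.
  whole (step c e q) = step (whole c) e q
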